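{- The nested Braid fan $\mathrm{Br}_d^2$ is the barycentric subdivision of the Braid fan $\mathrm{Br}_d$, and thus is the second barycentric subdivision of the normal fan $\Sigma(\Delta_d)$ of the standard simplex $\Delta_d=\mathrm{conv}\{\mathbf{e}_1,\dots,\mathbf{e}_{d+1}\}\subset\mathbb{R}^{d+1}$.
   Context: Let $V_d=\{\mathbf{x}\in\mathbb{R}^{d+1}:\sum_i x_i=0\}$ and $W_d=\mathbb{R}^{d+1}/\mathbb{R}\mathbf{1}$ (where $\mathbf{1}$ is the all-one vector), paired by $\langle \mathbf{w},\mathbf{x}\rangle=\sum_i w_ix_i$; all fans here live in $W_d$, and normal fans of polytopes lying in translates of $V_d$ are taken in $W_d$ (the normal cone of a face $F$ of $P$ is $\{\mathbf{w}\in W_d:\langle\mathbf{w},\mathbf{x}\rangle\ge\langle\mathbf{w},\mathbf{y}\rangle\ \forall \mathbf{x}\in F,\mathbf{y}\in P\}$). For $\pi\in\mathfrak{S}_{d+1}$ let $\sigma(\pi)=\{\mathbf{x}\in W_d: x_{\pi^{ -1}(1)}\le x_{\pi^{ -1}(2)}\le\cdots\le x_{\pi^{ -1}(d+1)}\}$; the Braid fan $\mathrm{Br}_d$ is the collection of all $\sigma(\pi)$ together with all their faces. For $\pi\in\mathfrak{S}_{d+1}$ and $\mathbf{x}\in W_d$ put $(\Delta\mathbf{x})^\pi_i=x_{\pi^{ -1}(i+1)}-x_{\pi^{ -1}(i)}$ for $1\le i\le d$. For $(\pi,\tau)\in\mathfrak{S}_{d+1}\times\mathfrak{S}_d$ let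 $\sigma(\pi,\tau)$ be the set of $\mathbf{x}\in W_d$ with $x_{\pi^{ -1}(1)}\le\cdots\le x_{\pi^{ -1}(d+1)}$ and $(\Delta\mathbf{x})^\pi_{\tau^{ -1}(1)}\le(\Delta\mathbf{x})^\pi_{\tau^{ -1}(2)}\le\cdots\le(\Delta\mathbf{x})^\pi_{\tau^{ -1}(d)}$; the nested Braid fan $\mathrm{Br}_d^2$ is the collection of all $\sigma(\pi,\tau)$ together with all their faces. Barycentric subdivision of a fan $\Sigma$ all of whose cones are pointed (with respect to the lattice $\mathbb{Z}^{d+1}/\mathbb{Z}\mathbf{1}$): for each nonzero cone $\tau\in\Sigma$ let $\rho_\tau$ be the sum of the primitive generators of the rays of $\tau$; the barycentric subdivision of $\Sigma$ is the fan consisting of $\{0\}$ and the cones $\mathrm{cone}(\rho_{\tau_1},\dots,\rho_{\tau_k})$ for all chains $\tau_1\subsetneq\tau_2\subsetneq\cdots\subsetneq\tau_k$ of nonzero cones of $\Sigma$ (equivalently, the fan obtained by successive stellar subdivisions of all cones of $\Sigma$ in order of decreasing dimension).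
   Formalization: The space W_d, its cones, the functionals cutting out faces, and the simplex Δ_d are taken over the rational numbers instead of the real numbers. -}

module Defs where

-- Fans in W_d = Q^{d+1} / Q·1, modelled over the rationals (no reals in stdlib).
-- Points of W_d are represented by vectors  Fin (suc d) → ℚ ; every region below
-- is invariant under adding constant vectors, so regions are subsets of W_d.

open import Level using (Level; 0ℓ; Lift; lift; lower) renaming (suc to lsuc)
open import Data.Nat using (ℕ; zero; suc)
open import Data.Fin using (Fin; zero; suc; inject₁)
open import Data.Integer using (ℤ)
open import Data.Rational using (ℚ; 0ℚ; 1ℚ; _+_; _*_; _-_; _≤_; _/_)
open import Data.Product using (Σ; ∃; _×_; _,_; proj₁; proj₂)
open import Data.Sum using (_⊎_)
open import Data.Unit using (⊤)
open import Data.List using (List; []; _∷_; map; foldr)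
open import Data.List.Membership.Propositional using (_∈_)
open import Data.List.Relation.Unary.All using (All)
open import Data.List.Relation.Unary.AllPairs using (AllPairs)
open import Data.List.Relation.Unary.Linked using (Linked)
open import Data.Fin.Permutation using (Permutation′; _⟨$⟩ˡ_)
open import Relation.Binary.PropositionalEquality using (_≡_)
open import Relation.Nullary using (¬_)

Pt : ℕ → Set
Pt d = Fin (suc d) → ℚ

Σᶠ : ∀ {n} → (Fin n → ℚ) → ℚ
Σᶠ {zero}  f = 0ℚ
Σᶠ {suc n} f = f zero + Σᶠ (λ i → f (suc i))

⟨_,_⟩ : ∀ {d} → Pt d → Pt d → ℚ
⟨ w , x ⟩ = Σᶠ (λ i → w i * x i)

_≥ℚ_ : ℚ → ℚ → Set
a ≥ℚ b = b ≤ a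

-- equality in W_d: differ by a constant vector
_~_ : ∀ {d} → Pt d → Pt d → Set
x ~ y = ∃ λ (c : ℚ) → ∀ i → x i ≡ y i + c

ι : ∀ {d} → (Fin (suc d) → ℤ) → Pt d
ι u i = u i / 1

_·_ : ∀ {d} → ℚ → Pt d → Pt d
(λ₀ · x) i = λ₀ * x i

0ᵖ : ∀ {d} → Pt d
0ᵖ i = 0ℚ

_⊕_ : ∀ {d} → Pt d → Pt d → Pt d
(x ⊕ y) i = x i + y i

sumᵖ : ∀ {d} → List (Pt d) → Pt d
sumᵖ = foldr _⊕_ 0ᵖ

Region : ℕ → Set₁
Region d = Pt d → Set

_⊆ʳ_ : ∀ {d} → Region d → Region d → Set
A ⊆ʳ B = ∀ x → A x → B x

_≐_ : ∀ {d} → Region d → Region d → Set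
A ≐ B = (A ⊆ʳ B) × (B ⊆ʳ A)

_⊊ʳ_ : ∀ {d} → Region d → Region d → Set
A ⊊ʳ B = (A ⊆ʳ B) × ¬ (B ⊆ʳ A)

zeroCone : ∀ {d} → Region d
zeroCone x = x ~ 0ᵖ

-- cone generated by a finite list of vectors (in W_d):
-- { Σ λ_j v_j + c·1 : λ_j ≥ 0 }
data ConeComb {d : ℕ} : List (Pt d) → Pt d → Set where
  [] : ∀ {x} → x ~ 0ᵖ → ConeComb [] x
  _∷_ : ∀ {v vs x} → (∃ λ (l : ℚ) → (l ≥ℚ 0ℚ) × ConeComb vs (λ i → x i - l * v i))
        → ConeComb (v ∷ vs) x

coneGen : ∀ {d} → List (Pt d) → Region d
coneGen vs = ConeComb vs

ray : ∀ {d} → Pt d → Region d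
ray v = coneGen (v ∷ [])

-- A linear functional on W_d is a vector w with Σ w_i = 0.
-- Face of a cone C cut out by a functional w that is ≥ 0 on C.
IsFaceFunctional : ∀ {d} → Region d → Pt d → Set
IsFaceFunctional C w = (Σᶠ w ≡ 0ℚ) × (∀ x → C x → ⟨ w , x ⟩ ≥ℚ 0ℚ)

face : ∀ {d} → Region d → Pt d → Region d
face C w x = C x × (⟨ w , x ⟩ ≡ 0ℚ)

record Fan (d : ℕ) : Set₂ where
  field
    Idx  : Set₁
    cone : Idx → Region d
open Fan public

_≈Fan_ : ∀ {d} → Fan d → Fan d → Set₁
Σ₁ ≈Fan Σ₂ =
  (∀ i → ∃ λ j → cone Σ₁ i ≐ cone Σ₂ j) ×
  (∀ j → ∃ λ i → cone Σ₂ j ≐ cone Σ₁ i)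

withFaces : ∀ {d} → (I : Set) → (I → Region d) → Fan d
withFaces {d} I σ = record
  { Idx  = Lift (lsuc 0ℓ) (Data.Product.Σ I (λ i → Data.Product.Σ (Pt d) (λ w → IsFaceFunctional (σ i) w)))
  ; cone = λ { (lift (i , w , _)) → face (σ i) w }
  }

-- π⁻¹(i) for i : Fin (suc d) ; we index positions 1..d+1 by Fin (suc d)
σBr : ∀ {d} → Permutation′ (suc d) → Region d
σBr {d} π x = ∀ (i : Fin d) → x (π ⟨$⟩ˡ inject₁ i) ≤ x (π ⟨$⟩ˡ suc i)

Br : (d : ℕ) → Fan d
Br d = withFaces (Permutation′ (suc d)) σBr

Δ : ∀ {d} → Permutation′ (suc d) → Pt d → Fin d → ℚ
Δ π x i = x (π ⟨$⟩ˡ suc i) - x (π ⟨$⟩ˡ inject₁ i)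

σBr² : ∀ {d} → Permutation′ (suc d) × Permutation′ d → Region d
σBr² {zero}  (π , τ) x = σBr π x
σBr² {suc d} (π , τ) x =
  σBr π x × (∀ (i : Fin d) → Δ π x (τ ⟨$⟩ˡ inject₁ i) ≤ Δ π x (τ ⟨$⟩ˡ suc i))

Br² : (d : ℕ) → Fan d
Br² d = withFaces (Permutation′ (suc d) × Permutation′ d) σBr²

IsRayOf : ∀ {d} → Region d → Region d → Set
IsRayOf C R =
  (∃ λ w → IsFaceFunctional C w × (R ≐ face C w)) ×
  (∃ λ v → ¬ (v ~ 0ᵖ) × (R ≐ ray v))

IsPrimGen : ∀ {d} → Region d → (Fin (suc d) → ℤ) → Set
IsPrimGen R u =
  ¬ (ι u ~ 0ᵖ) × (R ≐ ray (ι u)) ×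
  (∀ (v : Fin (suc _) → ℤ) → R (ι v) → ∃ λ (k : ℕ) → ι v ~ ((Data.Integer.+ k / 1) · ι u))

IsBaryPt : ∀ {d} → Region d → Pt d → Set₁
IsBaryPt {d} C ρ = ∃ λ (gs : List (Fin (suc d) → ℤ)) →
  All (λ u → ∃ λ R → IsRayOf C R × IsPrimGen R u) gs ×
  (∀ R → IsRayOf C R → ∃ λ u → (u ∈ gs) × IsPrimGen R u) ×
  AllPairs (λ u v → ¬ (ι u ~ ι v)) gs ×
  (ρ ≡ sumᵖ (map ι gs))

-- barycentric subdivision: {0} together with cone(ρ_{τ₁},…,ρ_{τ_k}) for chains
-- τ₁ ⊊ … ⊊ τ_k of nonzero cones of Σ.  (The empty chain gives coneGen [] = {0}.)
record ChainElt {d} (S : Fan d) : Set₁ where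
  constructor chainElt
  field
    idx  : Idx S
    ρ    : Pt d
    isρ  : IsBaryPt (cone S idx) ρ

Bary : ∀ {d} → Fan d → Fan d
Bary {d} S = record
  { Idx  = Data.Product.Σ (List (ChainElt S)) (λ ch →
             All (λ e → ¬ (cone S (ChainElt.idx e) ≐ zeroCone)) ch ×
             Linked (λ e e′ → cone S (ChainElt.idx e) ⊊ʳ cone S (ChainElt.idx e′)) ch)
  ; cone = λ ch → coneGen (map ChainElt.ρ (proj₁ ch))
  }

-- convex hull of finitely many points (in R^{d+1}, not modulo 1)
conv : ∀ {d m} → (Fin m → Pt d) → Pt d → Set
conv {d} {m} v x = ∃ λ (l : Fin m → ℚ) →
  (∀ j → l j ≥ℚ 0ℚ) × (Σᶠ l ≡ 1ℚ) × (∀ i → x i ≡ Σᶠ (λ j → l j * v j i))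

e : ∀ {d} → Fin (suc d) → Pt d
e i j with i Data.Fin.≟ j
... | Relation.Nullary.yes _ = 1ℚ
... | Relation.Nullary.no  _ = 0ℚ

stdSimplex : (d : ℕ) → Pt d → Set
stdSimplex d = conv (e {d})

maxFace : ∀ {d} → (Pt d → Set) → Pt d → Pt d → Set
maxFace P w x = P x × (∀ y → P y → ⟨ w , x ⟩ ≥ℚ ⟨ w , y ⟩)

normalCone : ∀ {d} → (Pt d → Set) → (Pt d → Set) → Region d
normalCone P F w = ∀ x y → F x → P y → ⟨ w , x ⟩ ≥ℚ ⟨ w , y ⟩

-- normal fan: normal cones of all nonempty faces (every nonempty face is maxFace P w for some w)
NormalFan : ∀ {d} → (Pt d → Set) → Fan d
NormalFan {d} P = record
  { Idx  = Lift (lsuc 0ℓ) (Pt d)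
  ; cone = λ w → normalCone P (maxFace P (lower w))
  }

{-# OPTIONS --safe #-}
module Submission where

-- In the coordinates dual to its ray generators, a cone of a unimodular simplicial fan is an
-- orthant {y ≥ 0, yᵢ = 0 for i ∉ P}, and its barycentre is the indicator vector of P.  A chain
-- P₁ ⊊ … ⊊ P_k of index sets consists of upper sets of some ordering τ of the coordinates, so
-- the cone over its barycentres is a face of {0 ≤ y_{τ⁻¹(1)} ≤ … ≤ y_{τ⁻¹(d)}}, and every face
-- of that cone arises in this way.  For the Braid fan y is the vector of consecutive differences,
-- which gives the nested Braid fan; for the normal fan of the simplex yⱼ = x_p − xⱼ with x_p
-- the maximal entry, which gives the Braid fan.

open import Defs
open import Level using (lift)
open import Data.Bool.Base using (Bool; true; false; if_then_else_; _∧_; not)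
import Data.Bool.Properties as Bool
open import Data.Nat.Base as ℕ using (ℕ; zero; suc; z≤n; s≤s)
import Data.Nat.Properties as ℕ
open import Data.Integer.Base as ℤ using (ℤ; -[1+_]; 0ℤ; 1ℤ; -1ℤ) renaming (+_ to pos)
import Data.Integer.Properties as ℤ
open import Data.Rational.Base
  using (ℚ; 0ℚ; 1ℚ; _+_; _*_; _-_; -_; 1/_; _≤_; _/_; nonNegative; ≢-nonZero; toℚᵘ)
import Data.Rational.Properties as ℚ
open import Data.Rational.Solver using (module +-*-Solver)
open import Data.Rational.Unnormalised.Base as ℚᵘ using (mkℚᵘ; *≡*; *≤*)
import Data.Rational.Unnormalised.Properties as ℚᵘ
open import Data.Fin.Base as Fin using (Fin; zero; suc; inject₁; punchIn; opposite)
open import Data.Fin.Properties as Fin using (_≟_; all?; any?; ¬∀⟶∃¬)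
open import Data.Fin.Permutation as Perm using (Permutation′; _⟨$⟩ˡ_; _⟨$⟩ʳ_)
open import Data.Product.Base using (∃; _×_; _,_; proj₁; proj₂)
open import Data.Sum.Base using (_⊎_; inj₁; inj₂)
open import Data.List.Base using (List; []; _∷_; map; filter; tabulate; allFin)
import Data.List.Extrema as Extrema
open import Data.List.Membership.Propositional using (_∈_; find; lose)
open import Data.List.Membership.Propositional.Properties
  using (∈-map⁺; ∈-filter⁺; ∈-allFin; ∈-tabulate⁺)
open import Data.List.Relation.Unary.Any as Any using (here; there)
open import Data.List.Relation.Unary.All as All using (All; []; _∷_)
import Data.List.Relation.Unary.All.Properties as All
open import Data.List.Relation.Unary.AllPairs as AllPairs using (AllPairs; []; _∷_)
import Data.List.Relation.Unary.AllPairs.Properties as AllPairs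
open import Data.List.Relation.Unary.Linked using (Linked; []; [-]; _∷_)
open import Data.List.Relation.Unary.Linked.Properties using (AllPairs⇒Linked)
open import Data.List.Relation.Binary.Pointwise.Base using (Pointwise; []; _∷_)
open import Function.Base using (_∘_)
open import Relation.Binary.Bundles using (DecTotalOrder)
open import Relation.Binary.PropositionalEquality
open import Relation.Nullary using (¬_; Dec; yes; no; does; contradiction)
open import Relation.Nullary.Decidable using (dec-true; dec-false; _×-dec_; map′)
open +-*-Solver using (solve; _:=_; _:+_; _:*_; _:-_; :-_; con)

-- The fans to be compared are given by unrelated formulas, so they are not compared directly: each
-- is shown to consist of exactly the orthants of one and the same family of coordinate systems
-- (`Framed`), and such a presentation determines a fan. The Braid fan is presented twice, once in
-- order to be subdivided and once in order to be recognised as a subdivision. The obstacle is that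
-- each member of a chain comes with coordinates of its own, whereas an ordering of the coordinates
-- makes sense only in a common system. The largest member supplies one, and the smaller members are
-- rewritten in it by `orthant-transport`. This is the one place where the cones have to fit
-- together as in a fan, and `Compatible` records what is used of that. Barycentres are defined
-- through primitive lattice generators, so the generators must be lattice vectors and the
-- coordinates integral on the lattice (`LatticeFrame`). This is what makes each ray contribute
-- exactly one unit, and that to a single coordinate.

private
  module ℕ-Extrema = Extrema ℕ.≤-totalOrder
  module ℚ-Extrema = Extrema (DecTotalOrder.totalOrder ℚ.≤-decTotalOrder)

-- Rational arithmetic and finite sums

[_]ℚ : Bool → ℚ
[ b ]ℚ = if b then 1ℚ else 0ℚ

δ : ∀ {n} → Fin n → Fin n → ℚ
δ i j = [ does (i ≟ j) ]ℚ

δ-refl : ∀ {n} (i : Fin n) → δ i i ≡ 1ℚ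
δ-refl i = cong [_]ℚ (dec-true (i ≟ i) refl)

δ-≢ : ∀ {n} {i j : Fin n} → i ≢ j → δ i j ≡ 0ℚ
δ-≢ {i = i} {j} i≢j = cong [_]ℚ (dec-false (i ≟ j) i≢j)

δ-sym : ∀ {n} (i j : Fin n) → δ i j ≡ δ j i
δ-sym i j with i ≟ j
... | yes refl = sym (δ-refl i)
... | no  i≢j  = sym (δ-≢ (i≢j ∘ sym))

δ-suc : ∀ {n} (i j : Fin n) → δ (suc i) (suc j) ≡ δ i j
δ-suc i j with i ≟ j
... | yes _ = refl
... | no  _ = refl

1≢0 : 1ℚ ≢ 0ℚ
1≢0 ()

0≤1 : 0ℚ ≤ 1ℚ
0≤1 = ℚ.nonNegative⁻¹ 1ℚ

≟0-[not] : ∀ b {q} → q ≡ [ not b ]ℚ → does (q ℚ.≟ 0ℚ) ≡ b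
≟0-[not] true  {q} eq = dec-true (q ℚ.≟ 0ℚ) eq
≟0-[not] false {q} eq = dec-false (q ℚ.≟ 0ℚ) (λ q≡0 → 1≢0 (trans (sym eq) q≡0))

0≤[_] : ∀ b → 0ℚ ≤ [ b ]ℚ
0≤[ true ]  = 0≤1
0≤[ false ] = ℚ.≤-refl

0≤+ : ∀ {p q} → 0ℚ ≤ p → 0ℚ ≤ q → 0ℚ ≤ p + q
0≤+ = ℚ.+-mono-≤

0≤* : ∀ {p q} → 0ℚ ≤ p → 0ℚ ≤ q → 0ℚ ≤ p * q
0≤* {p} {q} p≥0 q≥0 =
  ℚ.nonNegative⁻¹ (p * q) {{ℚ.nonNeg*nonNeg⇒nonNeg p {{nonNegative p≥0}} q {{nonNegative q≥0}}}}

≤⇒0≤- : ∀ {p q} → p ≤ q → 0ℚ ≤ q - p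
≤⇒0≤- {p} {q} p≤q = subst (_≤ q - p) (ℚ.+-inverseʳ p) (ℚ.+-monoˡ-≤ (- p) p≤q)

-+-cancel : ∀ p q → (q - p) + p ≡ q
-+-cancel = solve 2 (λ p q → (q :- p) :+ p := q) refl

0≤-⇒≤ : ∀ {p q} → 0ℚ ≤ q - p → p ≤ q
0≤-⇒≤ {p} {q} h = subst₂ _≤_ (ℚ.+-identityˡ p) (-+-cancel p q) (ℚ.+-monoˡ-≤ p h)

-≡0⇒≡ : ∀ {p q} → q - p ≡ 0ℚ → q ≡ p
-≡0⇒≡ {p} {q} h = trans (sym (-+-cancel p q)) (trans (cong (_+ p) h) (ℚ.+-identityˡ p))

+≡0⇒≡0 : ∀ {p q} → 0ℚ ≤ p → 0ℚ ≤ q → p + q ≡ 0ℚ → p ≡ 0ℚ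
+≡0⇒≡0 {p} {q} p≥0 q≥0 eq = ℚ.≤-antisym
  (subst₂ _≤_ (ℚ.+-identityʳ p) eq (ℚ.+-monoʳ-≤ p q≥0)) p≥0

*≡0⇒≡0 : ∀ {p q} → p ≢ 0ℚ → p * q ≡ 0ℚ → q ≡ 0ℚ
*≡0⇒≡0 {p} {q} p≢0 eq = begin
  q                  ≡⟨ ℚ.*-identityˡ q ⟨
  1ℚ * q             ≡⟨ cong (_* q) (ℚ.*-inverseˡ p {{nz}}) ⟨
  (p⁻¹ * p) * q      ≡⟨ ℚ.*-assoc p⁻¹ p q ⟩
  p⁻¹ * (p * q)      ≡⟨ cong (p⁻¹ *_) eq ⟩
  p⁻¹ * 0ℚ           ≡⟨ ℚ.*-zeroʳ p⁻¹ ⟩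
  0ℚ                 ∎
  where
  open ≡-Reasoning
  nz = ≢-nonZero p≢0
  p⁻¹ = (1/ p) {{nz}}

Σᶠ-cong : ∀ {n} {f g : Fin n → ℚ} → (∀ i → f i ≡ g i) → Σᶠ f ≡ Σᶠ g
Σᶠ-cong {zero}  h = refl
Σᶠ-cong {suc n} h = cong₂ _+_ (h zero) (Σᶠ-cong (h ∘ suc))

Σᶠ-zero : ∀ {n} {f : Fin n → ℚ} → (∀ i → f i ≡ 0ℚ) → Σᶠ f ≡ 0ℚ
Σᶠ-zero {zero}  h = refl
Σᶠ-zero {suc n} h = cong₂ _+_ (h zero) (Σᶠ-zero (h ∘ suc))

Σᶠ-+ : ∀ {n} (f g : Fin n → ℚ) → Σᶠ (λ i → f i + g i) ≡ Σᶠ f + Σᶠ g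
Σᶠ-+ {zero}  f g = refl
Σᶠ-+ {suc n} f g = trans (cong (f zero + g zero +_) (Σᶠ-+ (f ∘ suc) (g ∘ suc)))
  (solve 4 (λ a b c d → (a :+ b) :+ (c :+ d) := (a :+ c) :+ (b :+ d)) refl
    (f zero) (g zero) (Σᶠ (f ∘ suc)) (Σᶠ (g ∘ suc)))

Σᶠ-- : ∀ {n} (f g : Fin n → ℚ) → Σᶠ (λ i → f i - g i) ≡ Σᶠ f - Σᶠ g
Σᶠ-- {zero}  f g = refl
Σᶠ-- {suc n} f g = trans (cong (f zero - g zero +_) (Σᶠ-- (f ∘ suc) (g ∘ suc)))
  (solve 4 (λ a b c d → (a :- b) :+ (c :- d) := (a :+ c) :- (b :+ d)) refl
    (f zero) (g zero) (Σᶠ (f ∘ suc)) (Σᶠ (g ∘ suc)))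

Σᶠ-* : ∀ {n} c (f : Fin n → ℚ) → Σᶠ (λ i → c * f i) ≡ c * Σᶠ f
Σᶠ-* {zero}  c f = sym (ℚ.*-zeroʳ c)
Σᶠ-* {suc n} c f = trans (cong (c * f zero +_) (Σᶠ-* c (f ∘ suc)))
  (sym (ℚ.*-distribˡ-+ c (f zero) (Σᶠ (f ∘ suc))))

Σᶠ-swap : ∀ {m n} (f : Fin m → Fin n → ℚ) → Σᶠ (λ i → Σᶠ (f i)) ≡ Σᶠ (λ j → Σᶠ (λ i → f i j))
Σᶠ-swap {zero} {n} f = sym (Σᶠ-zero {n} λ _ → refl)
Σᶠ-swap {suc m} f = trans (cong (Σᶠ (f zero) +_) (Σᶠ-swap (f ∘ suc)))
  (sym (Σᶠ-+ (f zero) (λ j → Σᶠ (λ i → f (suc i) j))))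

0≤Σᶠ : ∀ {n} {f : Fin n → ℚ} → (∀ i → 0ℚ ≤ f i) → 0ℚ ≤ Σᶠ f
0≤Σᶠ {zero}  h = ℚ.≤-refl
0≤Σᶠ {suc n} h = 0≤+ (h zero) (0≤Σᶠ (h ∘ suc))

Σᶠ≡0⇒≡0 : ∀ {n} {f : Fin n → ℚ} → (∀ i → 0ℚ ≤ f i) → Σᶠ f ≡ 0ℚ → ∀ i → f i ≡ 0ℚ
Σᶠ≡0⇒≡0 h eq zero    = +≡0⇒≡0 (h zero) (0≤Σᶠ (h ∘ suc)) eq
Σᶠ≡0⇒≡0 {f = f} h eq (suc i) = Σᶠ≡0⇒≡0 (h ∘ suc)
  (+≡0⇒≡0 (0≤Σᶠ (h ∘ suc)) (h zero) (trans (ℚ.+-comm _ (f zero)) eq)) i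

Σᶠ-δ : ∀ {n} (i : Fin n) (f : Fin n → ℚ) → Σᶠ (λ j → δ i j * f j) ≡ f i
Σᶠ-δ zero f = trans
  (cong₂ _+_ (ℚ.*-identityˡ (f zero)) (Σᶠ-zero λ j → ℚ.*-zeroˡ (f (suc j))))
  (ℚ.+-identityʳ (f zero))
Σᶠ-δ (suc i) f = trans
  (cong₂ _+_ (ℚ.*-zeroˡ (f zero))
    (trans (Σᶠ-cong λ j → cong (_* f (suc j)) (δ-suc i j)) (Σᶠ-δ i (f ∘ suc))))
  (ℚ.+-identityˡ (f (suc i)))

e≡δ : ∀ {d} (i j : Fin (suc d)) → e {d} i j ≡ δ i j
e≡δ i j with i ≟ j
... | yes _ = refl
... | no  _ = refl

-- Cones and frames

infix 4 _≈_

-- _~_ as a record, so that unification can read off its arguments.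
record _≈_ {d} (x y : Pt d) : Set where
  constructor up
  field down : x ~ y
open _≈_

≗⇒≈ : ∀ {d} {x y : Pt d} → (∀ i → x i ≡ y i) → x ≈ y
≗⇒≈ {y = y} h = up (0ℚ , λ i → trans (h i) (sym (ℚ.+-identityʳ (y i))))

≈-refl : ∀ {d} {x : Pt d} → x ≈ x
≈-refl = ≗⇒≈ λ _ → refl

≈-sym : ∀ {d} {x y : Pt d} → x ≈ y → y ≈ x
≈-sym {x = x} {y} (up (c , h)) = up (- c , λ i → begin
  y i                ≡⟨ solve 2 (λ y c → y := (y :+ c) :- c) refl (y i) c ⟩
  (y i + c) - c      ≡⟨ cong (_- c) (h i) ⟨
  x i - c            ∎)
  where open ≡-Reasoning

≈-trans : ∀ {d} {x y z : Pt d} → x ≈ y → y ≈ z → x ≈ z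
≈-trans {z = z} (up (b , h)) (up (c , k)) = up (c + b , λ i →
  trans (h i) (trans (cong (_+ b) (k i)) (ℚ.+-assoc (z i) c b)))

⊕-≈ : ∀ {d} {x x′ y y′ : Pt d} → x ≈ x′ → y ≈ y′ → (x ⊕ y) ≈ (x′ ⊕ y′)
⊕-≈ {x′ = x′} {y′ = y′} (up (b , h)) (up (c , k)) = up (b + c , λ i → trans (cong₂ _+_ (h i) (k i))
  (solve 4 (λ x b y c → (x :+ b) :+ (y :+ c) := (x :+ y) :+ (b :+ c)) refl (x′ i) b (y′ i) c))

·-≈ : ∀ {d} l {x y : Pt d} → x ≈ y → (l · x) ≈ (l · y)
·-≈ l {y = y} (up (c , h)) = up (l * c , λ i → trans (cong (l *_) (h i)) (ℚ.*-distribˡ-+ l (y i) c))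

-- The difference x − l v in the shape in which ConeComb writes it.
_-⟨_⟩_ : ∀ {d} → Pt d → ℚ → Pt d → Pt d
(x -⟨ l ⟩ v) i = x i - l * v i

-⟨⟩-≈ : ∀ {d} l (v : Pt d) {x y} → x ≈ y → (x -⟨ l ⟩ v) ≈ (y -⟨ l ⟩ v)
-⟨⟩-≈ l v {y = y} (up (c , h)) = up (c , λ i → trans (cong (_- l * v i) (h i))
  (solve 3 (λ y c m → (y :+ c) :- m := (y :- m) :+ c) refl (y i) c (l * v i)))

⟨⟩-⊕ : ∀ {d} (w x y : Pt d) → ⟨ w , x ⊕ y ⟩ ≡ ⟨ w , x ⟩ + ⟨ w , y ⟩
⟨⟩-⊕ w x y = trans (Σᶠ-cong λ i → ℚ.*-distribˡ-+ (w i) (x i) (y i)) (Σᶠ-+ (λ i → w i * x i) (λ i → w i * y i))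

⟨⟩-· : ∀ {d} (w : Pt d) l x → ⟨ w , l · x ⟩ ≡ l * ⟨ w , x ⟩
⟨⟩-· w l x = trans
  (Σᶠ-cong λ i → solve 3 (λ w l x → w :* (l :* x) := l :* (w :* x)) refl (w i) l (x i))
  (Σᶠ-* l (λ i → w i * x i))

⟨⟩-- : ∀ {d} (w x : Pt d) l v → ⟨ w , x -⟨ l ⟩ v ⟩ ≡ ⟨ w , x ⟩ - l * ⟨ w , v ⟩
⟨⟩-- w x l v = begin
  ⟨ w , x -⟨ l ⟩ v ⟩
    ≡⟨ Σᶠ-cong (λ i → solve 4 (λ w x l v → w :* (x :- l :* v) := w :* (x :+ (:- l) :* v))
                              refl (w i) (x i) l (v i)) ⟩
  ⟨ w , x ⊕ ((- l) · v) ⟩            ≡⟨ ⟨⟩-⊕ w x ((- l) · v) ⟩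
  ⟨ w , x ⟩ + ⟨ w , (- l) · v ⟩      ≡⟨ cong (⟨ w , x ⟩ +_) (⟨⟩-· w (- l) v) ⟩
  ⟨ w , x ⟩ + (- l) * ⟨ w , v ⟩      ≡⟨ cong (⟨ w , x ⟩ +_) (sym (ℚ.neg-distribˡ-* l _)) ⟩
  ⟨ w , x ⟩ - l * ⟨ w , v ⟩          ∎
  where open ≡-Reasoning

⟨⟩-0ᵖ : ∀ {d} (w : Pt d) → ⟨ w , 0ᵖ ⟩ ≡ 0ℚ
⟨⟩-0ᵖ w = Σᶠ-zero λ i → ℚ.*-zeroʳ (w i)

⟨⟩-≈ : ∀ {d} (w : Pt d) → Σᶠ w ≡ 0ℚ → ∀ {x y} → x ≈ y → ⟨ w , x ⟩ ≡ ⟨ w , y ⟩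
⟨⟩-≈ w Σw≡0 {x} {y} (up (c , h)) = begin
  ⟨ w , x ⟩
    ≡⟨ Σᶠ-cong (λ i → trans (cong (w i *_) (h i))
         (solve 3 (λ w y c → w :* (y :+ c) := w :* y :+ c :* w) refl (w i) (y i) c)) ⟩
  Σᶠ (λ i → w i * y i + c * w i)     ≡⟨ Σᶠ-+ (λ i → w i * y i) (λ i → c * w i) ⟩
  ⟨ w , y ⟩ + Σᶠ (λ i → c * w i)     ≡⟨ cong (⟨ w , y ⟩ +_) (Σᶠ-* c w) ⟩
  ⟨ w , y ⟩ + c * Σᶠ w               ≡⟨ cong (λ s → ⟨ w , y ⟩ + c * s) Σw≡0 ⟩
  ⟨ w , y ⟩ + c * 0ℚ                 ≡⟨ cong (⟨ w , y ⟩ +_) (ℚ.*-zeroʳ c) ⟩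
  ⟨ w , y ⟩ + 0ℚ                     ≡⟨ ℚ.+-identityʳ _ ⟩
  ⟨ w , y ⟩                          ∎
  where open ≡-Reasoning

⟨⟩-Σᶠ : ∀ {d n} (w : Pt d) (f : Fin n → Pt d) →
        ⟨ w , (λ k → Σᶠ (λ i → f i k)) ⟩ ≡ Σᶠ (λ i → ⟨ w , f i ⟩)
⟨⟩-Σᶠ w f = trans (Σᶠ-cong λ k → sym (Σᶠ-* (w k) (λ i → f i k))) (Σᶠ-swap (λ k i → w k * f i k))

≐-refl : ∀ {d} {A : Region d} → A ≐ A
≐-refl = (λ _ h → h) , (λ _ h → h)

≐-sym : ∀ {d} {A B : Region d} → A ≐ B → B ≐ A
≐-sym (f , g) = g , f

≐-trans : ∀ {d} {A B C : Region d} → A ≐ B → B ≐ C → A ≐ C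
≐-trans (f , g) (h , k) = (λ x → h x ∘ f x) , (λ x → g x ∘ k x)

-- Generated cones and orthants are both instances, which reduces an inclusion from either kind into
-- the other to a check on generators.
record IsConvexCone {d} (C : Region d) : Set where
  field
    resp-≈ : ∀ {x y} → x ≈ y → C y → C x
    has-0  : C 0ᵖ
    has-⊕  : ∀ {x y} → C x → C y → C (x ⊕ y)
    has-·  : ∀ {l x} → 0ℚ ≤ l → C x → C (l · x)

  has-Σᶠ : ∀ {n} (f : Fin n → Pt d) → (∀ i → C (f i)) → C (λ k → Σᶠ (λ i → f i k))
  has-Σᶠ {zero}  f h = has-0
  has-Σᶠ {suc n} f h = has-⊕ (h zero) (has-Σᶠ (f ∘ suc) (h ∘ suc))

open IsConvexCone

≐-isConvexCone : ∀ {d} {A B : Region d} → A ≐ B → IsConvexCone B → IsConvexCone A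
≐-isConvexCone (f , g) B = record
  { resp-≈ = λ x≈y Ay → g _ (resp-≈ B x≈y (f _ Ay))
  ; has-0  = g _ (has-0 B)
  ; has-⊕  = λ Ax Ay → g _ (has-⊕ B (f _ Ax) (f _ Ay))
  ; has-·  = λ l≥0 Ax → g _ (has-· B l≥0 (f _ Ax))
  }

module _ {d : ℕ} where

  coneGen-≈ : ∀ vs {x y : Pt d} → x ≈ y → coneGen vs y → coneGen vs x
  coneGen-≈ []       x≈y ([] y~0)            = [] (down (≈-trans {z = 0ᵖ} x≈y (up y~0)))
  coneGen-≈ (v ∷ vs) x≈y (_∷_ (l , l≥0 , c)) = _∷_ (l , l≥0 , coneGen-≈ vs (-⟨⟩-≈ l v x≈y) c)

  x-0v≈x : ∀ (x v : Pt d) → (x -⟨ 0ℚ ⟩ v) ≈ x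
  x-0v≈x x v = ≗⇒≈ λ i → trans (cong (λ t → x i - t) (ℚ.*-zeroˡ (v i))) (ℚ.+-identityʳ (x i))

  coneGen-≈0 : ∀ vs {x : Pt d} → x ≈ 0ᵖ → coneGen vs x
  coneGen-≈0 []       x≈0 = [] (down x≈0)
  coneGen-≈0 (v ∷ vs) {x} x≈0 =
    _∷_ (0ℚ , ℚ.≤-refl , coneGen-≈0 vs (≈-trans (x-0v≈x x v) x≈0))

  coneGen-⊕ : ∀ vs {x y : Pt d} → coneGen vs x → coneGen vs y → coneGen vs (x ⊕ y)
  coneGen-⊕ []       {x} {y} ([] x~0) ([] y~0) = [] (down (≈-trans {y = 0ᵖ ⊕ 0ᵖ}
    (⊕-≈ (up {x = x} {0ᵖ} x~0) (up {x = y} {0ᵖ} y~0)) (≗⇒≈ λ _ → refl)))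
  coneGen-⊕ (v ∷ vs) {x} {y} (_∷_ (l , l≥0 , cx)) (_∷_ (m , m≥0 , cy)) =
    _∷_ (l + m , 0≤+ l≥0 m≥0 , coneGen-≈ vs (≗⇒≈ λ i → solve 5
      (λ x y l m v → (x :+ y) :- (l :+ m) :* v := (x :- l :* v) :+ (y :- m :* v)) refl
      (x i) (y i) l m (v i)) (coneGen-⊕ vs cx cy))

  coneGen-· : ∀ vs {m} {x : Pt d} → 0ℚ ≤ m → coneGen vs x → coneGen vs (m · x)
  coneGen-· []       {m} m≥0 ([] x~0) =
    [] (down (≈-trans (·-≈ m (up x~0)) (≗⇒≈ λ _ → ℚ.*-zeroʳ m)))
  coneGen-· (v ∷ vs) {m} {x} m≥0 (_∷_ (l , l≥0 , c)) =
    _∷_ (m * l , 0≤* m≥0 l≥0 , coneGen-≈ vs (≗⇒≈ λ i → solve 4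
      (λ m x l v → m :* x :- m :* l :* v := m :* (x :- l :* v)) refl m (x i) l (v i))
      (coneGen-· vs m≥0 c))

  coneGen-isConvexCone : ∀ vs → IsConvexCone (coneGen {d} vs)
  coneGen-isConvexCone vs = record
    { resp-≈ = coneGen-≈ vs
    ; has-0  = coneGen-≈0 vs ≈-refl
    ; has-⊕  = coneGen-⊕ vs
    ; has-·  = coneGen-· vs
    }

  coneGen-∈ : ∀ {vs} {v : Pt d} → v ∈ vs → coneGen vs v
  coneGen-∈ {v ∷ vs} (here refl) = _∷_ (1ℚ , 0≤1 , coneGen-≈0 vs (≗⇒≈ λ i →
    solve 1 (λ v → v :- con 1ℚ :* v := con 0ℚ) refl (v i)))
  coneGen-∈ {u ∷ vs} {v} (there p) =
    _∷_ (0ℚ , ℚ.≤-refl , coneGen-≈ vs (x-0v≈x v u) (coneGen-∈ p))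

  coneGen-minimal : ∀ {C : Region d} {vs} → IsConvexCone C → All C vs → coneGen vs ⊆ʳ C
  coneGen-minimal C []         x ([] x~0) = resp-≈ C (up x~0) (has-0 C)
  coneGen-minimal C (Cv ∷ Cvs) x (_∷_ {v = v} (l , l≥0 , c)) = resp-≈ C
    (≗⇒≈ λ i → solve 2 (λ x m → x := (x :- m) :+ m) refl (x i) (l * v i))
    (has-⊕ C (coneGen-minimal C Cvs _ c) (has-· C l≥0 Cv))

-- A basis `gen` of W_d with its dual basis `cov`. Spanning is not demanded of `gen`: separation of
-- points by the covectors is what the examples give directly, and together with duality it yields
-- spanning (`point-coord`).
record Frame (d n : ℕ) : Set where
  field
    cov      : Fin n → Pt d
    gen      : Fin n → Pt d
    cov-sum  : ∀ i → Σᶠ (cov i) ≡ 0ℚ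
    dual     : ∀ i j → ⟨ cov i , gen j ⟩ ≡ δ i j
    faithful : ∀ x → (∀ i → ⟨ cov i , x ⟩ ≡ 0ℚ) → x ≈ 0ᵖ

  coord : Fin n → Pt d → ℚ
  coord i x = ⟨ cov i , x ⟩

  coord-≈ : ∀ i {x y} → x ≈ y → coord i x ≡ coord i y
  coord-≈ i = ⟨⟩-≈ (cov i) (cov-sum i)

  coord-injective : ∀ {x y} → (∀ i → coord i x ≡ coord i y) → x ≈ y
  coord-injective {x} {y} h = ≈-trans
    (≗⇒≈ λ i → solve 2 (λ x y → x := (x :- con 1ℚ :* y) :+ y) refl (x i) (y i))
    (≈-trans (⊕-≈ {y = y} (faithful (x -⟨ 1ℚ ⟩ y) λ i → begin
        coord i (x -⟨ 1ℚ ⟩ y)              ≡⟨ ⟨⟩-- (cov i) x 1ℚ y ⟩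
        coord i x - 1ℚ * coord i y         ≡⟨ cong (_- 1ℚ * coord i y) (h i) ⟩
        coord i y - 1ℚ * coord i y
          ≡⟨ solve 1 (λ c → c :- con 1ℚ :* c := con 0ℚ) refl (coord i y) ⟩
        0ℚ                                 ∎) ≈-refl)
      (≗⇒≈ λ i → ℚ.+-identityˡ (y i)))
    where open ≡-Reasoning

  -- Equality modulo constants asks for an unknown rational; in coordinates it is finitely many
  -- comparisons. Index sets are Boolean, so coincidence of generators has to be decided when they
  -- are built.
  _≈?_ : ∀ x y → Dec (x ≈ y)
  x ≈? y = map′ coord-injective (λ x≈y i → coord-≈ i x≈y)
    (all? λ i → coord i x ℚ.≟ coord i y)

  nonzero-coord : ∀ {x} → ¬ (x ≈ 0ᵖ) → ∃ λ i → coord i x ≢ 0ℚ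
  nonzero-coord {x} x≁0 = ¬∀⟶∃¬ n (λ i → coord i x ≡ 0ℚ) (λ i → coord i x ℚ.≟ 0ℚ)
    (x≁0 ∘ faithful x)

  point : (Fin n → ℚ) → Pt d
  point c k = Σᶠ (λ i → c i * gen i k)

  ⟨,point⟩ : ∀ w c → ⟨ w , point c ⟩ ≡ Σᶠ (λ i → c i * ⟨ w , gen i ⟩)
  ⟨,point⟩ w c = trans (⟨⟩-Σᶠ w (λ i → c i · gen i)) (Σᶠ-cong λ i → ⟨⟩-· w (c i) (gen i))

  coord-point : ∀ c i → coord i (point c) ≡ c i
  coord-point c i = trans (⟨,point⟩ (cov i) c)
    (trans (Σᶠ-cong λ j → trans (ℚ.*-comm (c j) _) (cong (_* c j) (dual i j))) (Σᶠ-δ i c))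

  point-coord : ∀ x → x ≈ point (λ i → coord i x)
  point-coord x = coord-injective λ i → sym (coord-point (λ i → coord i x) i)

  gen≁0 : ∀ i → ¬ (gen i ≈ 0ᵖ)
  gen≁0 i g≈0 = 1≢0 (begin
    1ℚ                  ≡⟨ δ-refl i ⟨
    δ i i               ≡⟨ dual i i ⟨
    coord i (gen i)     ≡⟨ coord-≈ i g≈0 ⟩
    coord i 0ᵖ          ≡⟨ ⟨⟩-0ᵖ (cov i) ⟩
    0ℚ                  ∎)
    where open ≡-Reasoning

  gen-injective : ∀ {i j} → gen i ≈ gen j → i ≡ j
  gen-injective {i} {j} g≈g with i ≟ j
  ... | yes i≡j = i≡j
  ... | no  i≢j = contradiction (begin
    1ℚ                  ≡⟨ δ-refl i ⟨
    δ i i               ≡⟨ dual i i ⟨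
    coord i (gen i)     ≡⟨ coord-≈ i g≈g ⟩
    coord i (gen j)     ≡⟨ dual i j ⟩
    δ i j               ≡⟨ δ-≢ i≢j ⟩
    0ℚ                  ∎) 1≢0
    where open ≡-Reasoning

  functional : ∀ w → Σᶠ w ≡ 0ℚ → ∀ x → ⟨ w , x ⟩ ≡ Σᶠ (λ i → coord i x * ⟨ w , gen i ⟩)
  functional w Σw≡0 x = trans (⟨⟩-≈ w Σw≡0 (point-coord x)) (⟨,point⟩ w (λ i → coord i x))

  orthant : (Fin n → Bool) → Region d
  orthant P x = ∀ i → (0ℚ ≤ coord i x) × (P i ≡ false → coord i x ≡ 0ℚ)

  orthant-isConvexCone : ∀ P → IsConvexCone (orthant P)
  orthant-isConvexCone P = record
    { resp-≈ = λ x≈y oy i → subst (λ c → (0ℚ ≤ c) × (P i ≡ false → c ≡ 0ℚ))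
        (sym (coord-≈ i x≈y)) (oy i)
    ; has-0 = λ i → ℚ.≤-reflexive (sym (⟨⟩-0ᵖ (cov i))) , λ _ → ⟨⟩-0ᵖ (cov i)
    ; has-⊕ = λ {x} {y} ox oy i → subst (λ c → (0ℚ ≤ c) × (P i ≡ false → c ≡ 0ℚ))
        (sym (⟨⟩-⊕ (cov i) x y))
        (0≤+ (proj₁ (ox i)) (proj₁ (oy i)) ,
         λ Pi → cong₂ _+_ (proj₂ (ox i) Pi) (proj₂ (oy i) Pi))
    ; has-· = λ {l} {x} l≥0 ox i → subst (λ c → (0ℚ ≤ c) × (P i ≡ false → c ≡ 0ℚ))
        (sym (⟨⟩-· (cov i) l x))
        (0≤* l≥0 (proj₁ (ox i)) ,
         λ Pi → trans (cong (l *_) (proj₂ (ox i) Pi)) (ℚ.*-zeroʳ l))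
    }

  gen∈orthant : ∀ {P i} → P i ≡ true → orthant P (gen i)
  gen∈orthant {P} {i} Pi j = subst (λ c → (0ℚ ≤ c) × (P j ≡ false → c ≡ 0ℚ)) (sym (dual j i))
    (0≤[ does (j ≟ i) ] , λ Pj → δ-≢ {i = j} {i} λ { refl → contradiction (trans (sym Pi) Pj) λ () })

  gen∈orthant⁻ : ∀ {P i} → orthant P (gen i) → P i ≡ true
  gen∈orthant⁻ {P} {i} o with P i in Pi
  ... | true  = refl
  ... | false = contradiction
    (trans (sym (δ-refl i)) (trans (sym (dual i i)) (proj₂ (o i) Pi))) 1≢0

  -- Each point is the sum of the generators weighted by its coordinates, and the terms outside P
  -- vanish.
  orthant-minimal : ∀ {C P} → IsConvexCone C → (∀ i → P i ≡ true → C (gen i)) → orthant P ⊆ʳ C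
  orthant-minimal {C} {P} isC h x ox = resp-≈ isC (point-coord x) (has-Σᶠ isC (λ i → coord i x · gen i) term)
    where
    term : ∀ i → C (coord i x · gen i)
    term i with P i in Pi
    ... | true  = has-· isC (proj₁ (ox i)) (h i Pi)
    ... | false = resp-≈ isC
      (≗⇒≈ λ k → trans (cong (_* gen i k) (proj₂ (ox i) Pi)) (ℚ.*-zeroˡ (gen i k))) (has-0 isC)

  orthant-cong : ∀ {P Q} → (∀ i → P i ≡ Q i) → orthant P ≐ orthant Q
  orthant-cong h =
    (λ x o i → proj₁ (o i) , λ Qi → proj₂ (o i) (trans (h i) Qi)) ,
    (λ x o i → proj₁ (o i) , λ Pi → proj₂ (o i) (trans (sym (h i)) Pi))

  orthant-⊆⁻ : ∀ {P Q} → orthant P ⊆ʳ orthant Q → ∀ i → P i ≡ true → Q i ≡ true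
  orthant-⊆⁻ P⊆Q i Pi = gen∈orthant⁻ (P⊆Q (gen i) (gen∈orthant Pi))

  full : Fin n → Bool
  full _ = true

  killed : Pt d → Fin n → Bool
  killed w i = does (⟨ w , gen i ⟩ ℚ.≟ 0ℚ)

  killed⁻ : ∀ w i → ⟨ w , gen i ⟩ ≢ 0ℚ → killed w i ≡ false
  killed⁻ w i h = dec-false (⟨ w , gen i ⟩ ℚ.≟ 0ℚ) h

  -- On C the value of w is a sum of coordinates times values on generators, all terms nonnegative.
  -- If the sum is zero then every term is, so a coordinate can survive only where w vanishes on the
  -- generator.
  face-orthant : ∀ {C P} w → C ≐ orthant P → IsFaceFunctional C w →
                 face C w ≐ orthant (λ i → P i ∧ killed w i)
  face-orthant {C} {P} w (C⊆ , ⊆C) (Σw≡0 , w≥0) = to , from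
    where
    term≥0 : ∀ {x} → C x → ∀ i → 0ℚ ≤ coord i x * ⟨ w , gen i ⟩
    term≥0 {x} Cx i with P i in Pi
    ... | true  = 0≤* (proj₁ (C⊆ x Cx i)) (w≥0 (gen i) (⊆C (gen i) (gen∈orthant Pi)))
    ... | false = ℚ.≤-reflexive (sym (trans (cong (_* ⟨ w , gen i ⟩) (proj₂ (C⊆ x Cx i) Pi))
      (ℚ.*-zeroˡ ⟨ w , gen i ⟩)))

    to : face C w ⊆ʳ orthant (λ i → P i ∧ killed w i)
    to x (Cx , wx≡0) i = proj₁ (C⊆ x Cx i) , zero-off
      where
      zero-off : P i ∧ killed w i ≡ false → coord i x ≡ 0ℚ
      zero-off h with P i in Pi | ⟨ w , gen i ⟩ ℚ.≟ 0ℚ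
      ... | false | _        = proj₂ (C⊆ x Cx i) Pi
      ... | true  | no  wg≢0 = *≡0⇒≡0 wg≢0 (trans (ℚ.*-comm ⟨ w , gen i ⟩ _)
        (Σᶠ≡0⇒≡0 (term≥0 Cx) (trans (sym (functional w Σw≡0 x)) wx≡0) i))
      zero-off () | true | yes _

    from : orthant (λ i → P i ∧ killed w i) ⊆ʳ face C w
    from x ox = ⊆C x (λ i → proj₁ (ox i) , λ Pi → proj₂ (ox i) (cong (_∧ killed w i) Pi)) ,
      trans (functional w Σw≡0 x) (Σᶠ-zero term≡0)
      where
      term≡0 : ∀ i → coord i x * ⟨ w , gen i ⟩ ≡ 0ℚ
      term≡0 i with ⟨ w , gen i ⟩ ℚ.≟ 0ℚ
      ... | yes wg≡0 = trans (cong (coord i x *_) wg≡0) (ℚ.*-zeroʳ (coord i x))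
      ... | no  wg≢0 = trans (cong (_* ⟨ w , gen i ⟩) (proj₂ (ox i)
        (trans (cong (P i ∧_) (killed⁻ w i wg≢0)) (Bool.∧-zeroʳ (P i))))) (ℚ.*-zeroˡ ⟨ w , gen i ⟩)

  -- The functional that vanishes on exactly those generators gen i with Q i.
  cut : (Fin n → Bool) → Pt d
  cut Q k = Σᶠ (λ i → [ not (Q i) ]ℚ * cov i k)

  ⟨cut,⟩ : ∀ Q x → ⟨ cut Q , x ⟩ ≡ Σᶠ (λ i → [ not (Q i) ]ℚ * coord i x)
  ⟨cut,⟩ Q x = begin
    Σᶠ (λ k → Σᶠ (λ i → [ not (Q i) ]ℚ * cov i k) * x k)
      ≡⟨ Σᶠ-cong (λ k → ℚ.*-comm (cut Q k) (x k)) ⟩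
    Σᶠ (λ k → x k * Σᶠ (λ i → [ not (Q i) ]ℚ * cov i k))
      ≡⟨ ⟨⟩-Σᶠ x (λ i → [ not (Q i) ]ℚ · cov i) ⟩
    Σᶠ (λ i → ⟨ x , [ not (Q i) ]ℚ · cov i ⟩)
      ≡⟨ Σᶠ-cong (λ i → trans (⟨⟩-· x [ not (Q i) ]ℚ (cov i)) (cong ([ not (Q i) ]ℚ *_)
           (Σᶠ-cong λ k → ℚ.*-comm (x k) (cov i k)))) ⟩
    Σᶠ (λ i → [ not (Q i) ]ℚ * coord i x) ∎
    where open ≡-Reasoning

  cut-sum : ∀ Q → Σᶠ (cut Q) ≡ 0ℚ
  cut-sum Q = trans (Σᶠ-swap (λ k i → [ not (Q i) ]ℚ * cov i k))
    (Σᶠ-zero λ i → trans (Σᶠ-* [ not (Q i) ]ℚ (cov i))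
      (trans (cong ([ not (Q i) ]ℚ *_) (cov-sum i)) (ℚ.*-zeroʳ [ not (Q i) ]ℚ)))

  cut-isFaceFunctional : ∀ {C P} Q → C ≐ orthant P → IsFaceFunctional C (cut Q)
  cut-isFaceFunctional Q (C⊆ , _) = cut-sum Q , λ x Cx → subst (0ℚ ≤_) (sym (⟨cut,⟩ Q x))
    (0≤Σᶠ λ i → 0≤* 0≤[ not (Q i) ] (proj₁ (C⊆ x Cx i)))

  ⟨cut,gen⟩ : ∀ Q i → ⟨ cut Q , gen i ⟩ ≡ [ not (Q i) ]ℚ
  ⟨cut,gen⟩ Q i = begin
    ⟨ cut Q , gen i ⟩                              ≡⟨ ⟨cut,⟩ Q (gen i) ⟩
    Σᶠ (λ j → [ not (Q j) ]ℚ * coord j (gen i))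
      ≡⟨ Σᶠ-cong (λ j → trans (ℚ.*-comm [ not (Q j) ]ℚ (coord j (gen i)))
           (cong (_* [ not (Q j) ]ℚ) (trans (dual j i) (δ-sym j i)))) ⟩
    Σᶠ (λ j → δ i j * [ not (Q j) ]ℚ)              ≡⟨ Σᶠ-δ i (λ j → [ not (Q j) ]ℚ) ⟩
    [ not (Q i) ]ℚ                                 ∎
    where open ≡-Reasoning

  killed-cut : ∀ Q i → killed (cut Q) i ≡ Q i
  killed-cut Q i = ≟0-[not] (Q i) (⟨cut,gen⟩ Q i)

  -- As Q is arbitrary, every subset of the generators of a simplicial cone spans a face of it.
  face-cut : ∀ {C P} Q → C ≐ orthant P → face C (cut Q) ≐ orthant (λ i → P i ∧ Q i)
  face-cut {P = P} Q C≐ = ≐-trans (face-orthant (cut Q) C≐ (cut-isFaceFunctional Q C≐))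
    (orthant-cong λ i → cong (P i ∧_) (killed-cut Q i))

-- Rays and barycentres of orthants

toℚᵘ-/1 : ∀ z → toℚᵘ (z / 1) ℚᵘ.≃ mkℚᵘ z 0
toℚᵘ-/1 z = ℚ.toℚᵘ-fromℚᵘ (mkℚᵘ z 0)

/1-injective : ∀ {a b} → a / 1 ≡ b / 1 → a ≡ b
/1-injective {a} {b} eq with ℚᵘ.≃-trans (ℚᵘ.≃-sym (toℚᵘ-/1 a))
  (ℚᵘ.≃-trans (ℚᵘ.≃-reflexive (cong toℚᵘ eq)) (toℚᵘ-/1 b))
... | *≡* h = trans (sym (ℤ.*-identityʳ a)) (trans h (ℤ.*-identityʳ b))

/1-homo-* : ∀ a b → (a ℤ.* b) / 1 ≡ (a / 1) * (b / 1)
/1-homo-* a b = ℚ.toℚᵘ-injective (ℚᵘ.≃-trans (toℚᵘ-/1 (a ℤ.* b)) (ℚᵘ.≃-sym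
  (ℚᵘ.≃-trans (ℚ.toℚᵘ-homo-* (a / 1) (b / 1)) (ℚᵘ.*-cong (toℚᵘ-/1 a) (toℚᵘ-/1 b)))))

/1-homo-- : ∀ a b → (a ℤ.- b) / 1 ≡ a / 1 - b / 1
/1-homo-- a b = ℚ.toℚᵘ-injective (begin
  toℚᵘ ((a ℤ.- b) / 1)                      ≈⟨ toℚᵘ-/1 (a ℤ.- b) ⟩
  mkℚᵘ (a ℤ.- b) 0
    ≡⟨ cong₂ (λ x y → mkℚᵘ (x ℤ.+ y) 0) (ℤ.*-identityʳ a) (ℤ.*-identityʳ (ℤ.- b)) ⟨
  mkℚᵘ a 0 ℚᵘ.- mkℚᵘ b 0
    ≈⟨ ℚᵘ.+-cong (toℚᵘ-/1 a) (ℚᵘ.-‿cong (toℚᵘ-/1 b)) ⟨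
  toℚᵘ (a / 1) ℚᵘ.- toℚᵘ (b / 1)
    ≈⟨ ℚᵘ.+-congʳ (toℚᵘ (a / 1)) (ℚ.toℚᵘ-homo‿- (b / 1)) ⟨
  toℚᵘ (a / 1) ℚᵘ.+ toℚᵘ (- (b / 1))        ≈⟨ ℚ.toℚᵘ-homo-+ (a / 1) (- (b / 1)) ⟨
  toℚᵘ (a / 1 - b / 1)                      ∎)
  where open ℚᵘ.≃-Reasoning

0≤/1⇒ℕ : ∀ z → 0ℚ ≤ z / 1 → ∃ λ k → z ≡ pos k
0≤/1⇒ℕ (pos k)    _ = k , refl
0≤/1⇒ℕ (-[1+ n ]) h with ℚᵘ.≤-trans (ℚ.toℚᵘ-mono-≤ h) (ℚᵘ.≤-reflexive (toℚᵘ-/1 -[1+ n ]))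
... | *≤* ()

ℕ-unit : ∀ k z → 1ℚ ≡ (pos k / 1) * (z / 1) → k ≡ 1
ℕ-unit k z eq = ℕ.m*n≡1⇒m≡1 k ℤ.∣ z ∣ (trans (sym (ℤ.abs-* (pos k) z))
  (cong ℤ.∣_∣ (sym (/1-injective {pos 1} {pos k ℤ.* z} (trans eq (sym (/1-homo-* (pos k) z)))))))

-- Unimodularity: the generators are lattice vectors and the covectors are integral on the lattice,
-- so they form dual bases of the lattice and of its dual.
record LatticeFrame (d n : ℕ) : Set where
  field
    frame   : Frame d n
    igen    : Fin n → Fin (suc d) → ℤ
    ι-igen  : ∀ i → ι (igen i) ≈ Frame.gen frame i
    cov-int : ∀ i u → ∃ λ z → Frame.coord frame i (ι u) ≡ z / 1

single : ∀ {n} → Fin n → Fin n → Bool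
single i j = does (i ≟ j)

single-refl : ∀ {n} (i : Fin n) → single i i ≡ true
single-refl i = dec-true (i ≟ i) refl

single⁻ : ∀ {n} {i j : Fin n} → single i j ≡ true → i ≡ j
single⁻ {i = i} {j} h with i ≟ j
... | yes i≡j = i≡j

single-false : ∀ {n} {i j : Fin n} → single i j ≡ false → i ≢ j
single-false {i = i} h refl = contradiction (trans (sym (single-refl i)) h) λ ()

∧-trueˡ : ∀ {a b} → a ∧ b ≡ true → a ≡ true
∧-trueˡ {true} _ = refl

true-or-false : ∀ {A : Set} b → (b ≡ false → A) → (b ≡ true → A) → A
true-or-false false f t = f refl
true-or-false true  f t = t refl

ray-mono : ∀ {d} {u v : Pt d} → u ≈ v → ray u ⊆ʳ ray v
ray-mono {v = v} u≈v = coneGen-minimal (coneGen-isConvexCone (v ∷ []))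
  (resp-≈ (coneGen-isConvexCone (v ∷ [])) u≈v (coneGen-∈ (here refl)) ∷ [])

module _ {d n : ℕ} (L : LatticeFrame d n) where
  open LatticeFrame L
  open Frame frame

  ray-gen : ∀ i → ray (gen i) ≐ orthant (single i)
  ray-gen i =
    coneGen-minimal (orthant-isConvexCone (single i)) (gen∈orthant (single-refl i) ∷ []) ,
    orthant-minimal (coneGen-isConvexCone (gen i ∷ []))
      (λ j h → subst (λ k → ray (gen i) (gen k)) (single⁻ h) (coneGen-∈ (here refl)))

  ray-coord : ∀ {v x} → ray v x → ∃ λ l → ∀ j → coord j x ≡ l * coord j v
  ray-coord {v} {x} (_∷_ (l , _ , [] x-lv~0)) = l , λ j → -≡0⇒≡ (trans (sym (⟨⟩-- (cov j) x l v))
    (trans (coord-≈ j (up {y = 0ᵖ} x-lv~0)) (⟨⟩-0ᵖ (cov j))))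

  -- A ray spanned by v with vᵢ ≠ 0 is a face, so it contains gen i, and v is a multiple of gen i.
  isRayOf⇒single : ∀ {C R P} → C ≐ orthant P → IsRayOf C R →
                   ∃ λ i → (P i ≡ true) × (R ≐ orthant (single i))
  isRayOf⇒single {C} {R} {P} C≐ ((w , wff , R≐face) , v , v≁0 , R≐ray) =
    i , ∧-trueˡ Qi , to , from
    where
    Q = λ j → P j ∧ killed w j

    R≐Q : R ≐ orthant Q
    R≐Q = ≐-trans R≐face (face-orthant w C≐ wff)

    i : Fin n
    i = proj₁ (nonzero-coord (v≁0 ∘ down))

    vᵢ≢0 : coord i v ≢ 0ℚ
    vᵢ≢0 = proj₂ (nonzero-coord (v≁0 ∘ down))

    v∈R : R v
    v∈R = proj₂ R≐ray v (coneGen-∈ (here refl))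

    Qi : Q i ≡ true
    Qi = true-or-false (Q i) (λ Qi → contradiction (proj₂ (proj₁ R≐Q v v∈R i) Qi) vᵢ≢0) λ h → h

    gen∈R : R (gen i)
    gen∈R = proj₂ R≐Q (gen i) (gen∈orthant Qi)

    scale : ∃ λ l → ∀ j → coord j (gen i) ≡ l * coord j v
    scale = ray-coord (proj₁ R≐ray (gen i) gen∈R)

    l≢0 : proj₁ scale ≢ 0ℚ
    l≢0 l≡0 = 1≢0 (begin
      1ℚ                          ≡⟨ δ-refl i ⟨
      δ i i                       ≡⟨ dual i i ⟨
      coord i (gen i)             ≡⟨ proj₂ scale i ⟩
      proj₁ scale * coord i v     ≡⟨ cong (_* coord i v) l≡0 ⟩
      0ℚ * coord i v              ≡⟨ ℚ.*-zeroˡ (coord i v) ⟩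
      0ℚ                          ∎)
      where open ≡-Reasoning

    vⱼ≡0 : ∀ {j} → i ≢ j → coord j v ≡ 0ℚ
    vⱼ≡0 {j} i≢j = *≡0⇒≡0 l≢0
      (trans (sym (proj₂ scale j)) (trans (dual j i) (δ-≢ (i≢j ∘ sym))))

    to : R ⊆ʳ orthant (single i)
    to x Rx j = proj₁ (proj₁ R≐Q x Rx j) , λ h → let (m , eq) = ray-coord (proj₁ R≐ray x Rx) in
      trans (eq j) (trans (cong (m *_) (vⱼ≡0 (single-false h))) (ℚ.*-zeroʳ m))

    from : orthant (single i) ⊆ʳ R
    from = orthant-minimal (≐-isConvexCone R≐Q (orthant-isConvexCone Q))
      (λ j h → subst (R ∘ gen) (single⁻ h) gen∈R)

  single-isRayOf : ∀ {C P i} → C ≐ orthant P → P i ≡ true → IsRayOf C (orthant (single i))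
  single-isRayOf {C} {P} {i} C≐ Pi =
    (cut (single i) , cut-isFaceFunctional (single i) C≐ ,
      ≐-sym (≐-trans (face-cut (single i) C≐) (orthant-cong below))) ,
    gen i , gen≁0 i ∘ up , ≐-sym (ray-gen i)
    where
    below : ∀ j → P j ∧ single i j ≡ single i j
    below j with i ≟ j
    ... | yes refl = trans (Bool.∧-identityʳ (P i)) Pi
    ... | no  _    = Bool.∧-zeroʳ (P j)

  gen∈single : ∀ {R i} → R ≐ orthant (single i) → R (ι (igen i))
  gen∈single {i = i} R≐ = proj₂ R≐ _ (resp-≈ (orthant-isConvexCone (single i)) (ι-igen i)
    (gen∈orthant (single-refl i)))

  -- The lattice vector `igen i` lies on the ray, so it is k times u for a natural k. The i-th
  -- covector is integral on u, and applying it gives 1 = k z with an integer z, whence k = 1.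
  isPrimGen-unique : ∀ {R i} u → R ≐ orthant (single i) → IsPrimGen R u → ι u ≈ gen i
  isPrimGen-unique {R} {i} u R≐ (_ , _ , generates) =
    ≈-trans (≗⇒≈ λ j → sym (trans (cong (λ k → (pos k / 1) * ι u j) k≡1) (ℚ.*-identityˡ (ι u j))))
      (≈-trans (≈-sym igen≈ku) (ι-igen i))
    where
    k : ℕ
    k = proj₁ (generates (igen i) (gen∈single R≐))

    igen≈ku : ι (igen i) ≈ ((pos k / 1) · ι u)
    igen≈ku = up (proj₂ (generates (igen i) (gen∈single R≐)))

    k≡1 : k ≡ 1
    k≡1 = ℕ-unit k (proj₁ (cov-int i u)) (begin
      1ℚ                                     ≡⟨ δ-refl i ⟨
      δ i i                                  ≡⟨ dual i i ⟨
      coord i (gen i)                        ≡⟨ coord-≈ i (ι-igen i) ⟨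
      coord i (ι (igen i))                   ≡⟨ coord-≈ i igen≈ku ⟩
      coord i ((pos k / 1) · ι u)              ≡⟨ ⟨⟩-· (cov i) (pos k / 1) (ι u) ⟩
      (pos k / 1) * coord i (ι u)              ≡⟨ cong ((pos k / 1) *_) (proj₂ (cov-int i u)) ⟩
      (pos k / 1) * (proj₁ (cov-int i u) / 1)  ∎)
      where open ≡-Reasoning

  igen-isPrimGen : ∀ {R i} → R ≐ orthant (single i) → IsPrimGen R (igen i)
  igen-isPrimGen {R} {i} R≐ =
    (λ g~0 → gen≁0 i (≈-trans (≈-sym (ι-igen i)) (up g~0))) ,
    ≐-trans R≐ (≐-trans (≐-sym (ray-gen i)) (ray-mono (≈-sym (ι-igen i)) , ray-mono (ι-igen i))) ,
    multiple
    where
    multiple : ∀ v → R (ι v) → ∃ λ k → ι v ~ ((pos k / 1) · ι (igen i))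
    multiple v Rv = k , down (coord-injective {y = (pos k / 1) · ι (igen i)} λ j → trans (agree j)
      (sym (trans (⟨⟩-· (cov j) (pos k / 1) (ι (igen i)))
        (cong ((pos k / 1) *_) (trans (coord-≈ j (ι-igen i)) (dual j i))))))
      where
      v∈ = proj₁ R≐ (ι v) Rv
      -- The multiplicity of v is its i-th coordinate: an integer because the covector is integral,
      -- and nonnegative because v lies on the ray.
      z = proj₁ (cov-int i v)
      zk : ∃ λ k → z ≡ pos k
      zk = 0≤/1⇒ℕ z (subst (0ℚ ≤_) (proj₂ (cov-int i v)) (proj₁ (v∈ i)))
      k = proj₁ zk

      agree : ∀ j → coord j (ι v) ≡ (pos k / 1) * δ j i
      agree j = by-cases (j ≟ i)
        where
        by-cases : Dec (j ≡ i) → coord j (ι v) ≡ (pos k / 1) * δ j i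
        by-cases (yes refl) = trans (trans (proj₂ (cov-int i v)) (cong (_/ 1) (proj₂ zk)))
          (sym (trans (cong ((pos k / 1) *_) (δ-refl i)) (ℚ.*-identityʳ (pos k / 1))))
        by-cases (no j≢i) = trans (proj₂ (v∈ j) (dec-false (i ≟ j) (j≢i ∘ sym)))
          (sym (trans (cong ((pos k / 1) *_) (δ-≢ j≢i)) (ℚ.*-zeroʳ (pos k / 1))))

  coord-sumᵖ-zero : ∀ {i us} → All (λ u → coord i (ι u) ≡ 0ℚ) us →
                    coord i (sumᵖ (map ι us)) ≡ 0ℚ
  coord-sumᵖ-zero {i} []       = ⟨⟩-0ᵖ (cov i)
  coord-sumᵖ-zero {i} {u ∷ us} (h ∷ hs) =
    trans (⟨⟩-⊕ (cov i) (ι u) (sumᵖ (map ι us))) (cong₂ _+_ h (coord-sumᵖ-zero hs))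

  coord-other : ∀ {i j x} → x ≈ gen j → i ≢ j → coord i x ≡ 0ℚ
  coord-other {i} {j} x≈g i≢j = trans (coord-≈ i x≈g) (trans (dual i j) (δ-≢ i≢j))

  -- The entries are generators, pairwise distinct modulo constants, so exactly one of them
  -- contributes to the i-th coordinate.
  coord-sumᵖ-one : ∀ {i u us} → All (λ v → ∃ λ j → ι v ≈ gen j) us →
                   AllPairs (λ v v′ → ¬ (ι v ~ ι v′)) us → u ∈ us → ι u ≈ gen i →
                   coord i (sumᵖ (map ι us)) ≡ 1ℚ
  coord-sumᵖ-one {i} {u} {_ ∷ us} (_ ∷ gs) (u≁ ∷ _) (here refl) u≈g = begin
    coord i (ι u ⊕ sumᵖ (map ι us))                 ≡⟨ ⟨⟩-⊕ (cov i) (ι u) (sumᵖ (map ι us)) ⟩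
    coord i (ι u) + coord i (sumᵖ (map ι us))
      ≡⟨ cong₂ _+_ (trans (coord-≈ i u≈g) (trans (dual i i) (δ-refl i)))
                   (coord-sumᵖ-zero (All.zipWith
           (λ { ((j , v≈g) , u≁v) → coord-other v≈g
             λ { refl → u≁v (down (≈-trans u≈g (≈-sym v≈g))) } }) (gs , u≁))) ⟩
    1ℚ + 0ℚ                                         ≡⟨ ℚ.+-identityʳ 1ℚ ⟩
    1ℚ                                              ∎
    where open ≡-Reasoning
  coord-sumᵖ-one {i} {u} {v ∷ us} ((j , v≈g) ∷ gs) (v≁ ∷ us≁) (there u∈us) u≈g = begin
    coord i (ι v ⊕ sumᵖ (map ι us))                 ≡⟨ ⟨⟩-⊕ (cov i) (ι v) (sumᵖ (map ι us)) ⟩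
    coord i (ι v) + coord i (sumᵖ (map ι us))
      ≡⟨ cong₂ _+_ (coord-other v≈g
           λ { refl → All.lookup v≁ u∈us (down (≈-trans v≈g (≈-sym u≈g))) })
           (coord-sumᵖ-one gs us≁ u∈us u≈g) ⟩
    0ℚ + 1ℚ                                         ≡⟨ ℚ.+-identityˡ 1ℚ ⟩
    1ℚ                                              ∎
    where open ≡-Reasoning

  -- The list behind a barycentre is free in its order and in its representatives modulo constants.
  -- Its entries are nevertheless the generators in P, each occurring once, so the point is
  -- determined in W_d.
  coord-baryPt : ∀ {C P ρ} → C ≐ orthant P → IsBaryPt C ρ → ∀ i → coord i ρ ≡ [ P i ]ℚ
  coord-baryPt {C} {P} C≐ (us , rays , complete , distinct , refl) i =
    true-or-false (P i) outside inside
    where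
    gens : All (λ u → ∃ λ j → (P j ≡ true) × (ι u ≈ gen j)) us
    gens = All.map (λ { {u} (R , R-ray , R-prim) → let (j , Pj , R≐) = isRayOf⇒single C≐ R-ray in
      j , Pj , isPrimGen-unique u R≐ R-prim }) rays

    outside : P i ≡ false → coord i (sumᵖ (map ι us)) ≡ [ P i ]ℚ
    outside Pi = trans (coord-sumᵖ-zero (All.map (λ { (j , Pj , u≈g) → coord-other u≈g
      λ { refl → contradiction (trans (sym Pj) Pi) λ () } }) gens)) (cong [_]ℚ (sym Pi))

    inside : P i ≡ true → coord i (sumᵖ (map ι us)) ≡ [ P i ]ℚ
    inside Pi = let (u , u∈us , u-prim) = complete _ (single-isRayOf C≐ Pi) in
      trans (coord-sumᵖ-one (All.map (λ { (j , _ , u≈g) → j , u≈g }) gens) distinct u∈us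
        (isPrimGen-unique u ≐-refl u-prim)) (cong [_]ℚ (sym Pi))

  members : (Fin n → Bool) → List (Fin n)
  members P = filter (λ i → P i Bool.≟ true) (allFin n)

  -- A chain element carries its barycentre as data, so building chains requires an explicit one.
  orthant-baryPt : ∀ {C P} → C ≐ orthant P → IsBaryPt C (sumᵖ (map ι (map igen (members P))))
  orthant-baryPt {C} {P} C≐ =
    map igen (members P) ,
    All.map⁺ (All.map (λ {i} Pi → orthant (single i) , single-isRayOf C≐ Pi , igen-isPrimGen ≐-refl)
      (All.all-filter P? (allFin n))) ,
    (λ R R-ray → let (i , Pi , R≐) = isRayOf⇒single C≐ R-ray in
      igen i , ∈-map⁺ igen (∈-filter⁺ P? (∈-allFin i) Pi) , igen-isPrimGen R≐) ,
    AllPairs.map⁺ (AllPairs.filter⁺ P? (AllPairs.tabulate⁺ λ {i} {j} i≢j gi~gj →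
      i≢j (gen-injective (≈-trans (≈-sym (ι-igen i)) (≈-trans (up gi~gj) (ι-igen j)))))) ,
    refl
    where
    P? = λ i → P i Bool.≟ true

-- Sorted frames

sort : ∀ {n} (f : Fin n → ℕ) →
       ∃ λ (τ : Permutation′ n) → ∀ {i j} → i Fin.≤ j → f (τ ⟨$⟩ˡ i) ℕ.≤ f (τ ⟨$⟩ˡ j)
sort {zero}  f = Perm.id , λ { {()} }
sort {suc n} f = Perm.flip ρ , sorted
  where
  m = ℕ-Extrema.argmin f zero (allFin (suc n))

  min : ∀ i → f m ℕ.≤ f i
  min i = All.lookup (ℕ-Extrema.f[argmin]≤f[xs] {f = f} zero (allFin (suc n))) (∈-allFin i)

  τ = sort (f ∘ punchIn m)
  -- Selection sort: an index of least value takes position zero. The insertion maps positions to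
  -- indices, whereas the results are read through their inverses, hence the flips.
  ρ = Perm.insert zero m (Perm.flip (proj₁ τ))

  ρ-suc : ∀ i → ρ ⟨$⟩ʳ suc i ≡ punchIn m (proj₁ τ ⟨$⟩ˡ i)
  ρ-suc = Perm.insert-punchIn zero m (Perm.flip (proj₁ τ))

  sorted : ∀ {i j} → i Fin.≤ j → f (ρ ⟨$⟩ʳ i) ℕ.≤ f (ρ ⟨$⟩ʳ j)
  sorted {zero}          _         = min _
  sorted {suc i} {suc j} (s≤s i≤j) =
    subst₂ (λ a b → f a ℕ.≤ f b) (sym (ρ-suc i)) (sym (ρ-suc j)) (proj₂ τ i≤j)

-- The test m ≤ k. The sets obtained by varying m are the nonempty upper sets of a finite linear
-- order, indexed by their least elements.
upset : ∀ {n} → Fin n → Fin n → Bool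
upset zero    _       = true
upset (suc m) zero    = false
upset (suc m) (suc k) = upset m k

upset-refl : ∀ {n} (m : Fin n) → upset m m ≡ true
upset-refl zero    = refl
upset-refl (suc m) = upset-refl m

upset-antitone : ∀ {n} {i j : Fin n} k → i Fin.≤ j → upset j k ≡ true → upset i k ≡ true
upset-antitone {i = zero}              k       _         _ = refl
upset-antitone {i = suc i} {j = suc j} (suc k) (s≤s i≤j) h = upset-antitone k i≤j h

upset-< : ∀ {n} {i j : Fin n} → i Fin.< j → upset j i ≡ false
upset-< {i = zero}  {suc j} _         = refl
upset-< {i = suc i} {suc j} (s≤s i<j) = upset-< i<j

isUpset : ∀ {n} (g : Fin n → Bool) → (∀ {i j} → i Fin.≤ j → g i ≡ true → g j ≡ true) →
          (∃ λ i → g i ≡ true) → ∃ λ m → ∀ k → g k ≡ upset m k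
isUpset {suc n} g closed (i , gi) with g zero in g0
... | true  = zero , λ k → closed z≤n g0
... | false = let (m , h) = isUpset (g ∘ suc) (closed ∘ s≤s) (pred i gi) in
  suc m , λ { zero → g0 ; (suc k) → h k }
  where
  pred : ∀ i → g i ≡ true → ∃ λ j → g (suc j) ≡ true
  pred zero    g0′ = contradiction (trans (sym g0) g0′) λ ()
  pred (suc j) gj  = j , gj

-- The first value counts as a difference from 0, so that n differences determine the n values, and
-- nonnegative differences mean that the values increase from some value at least 0.
diff : ∀ {n} → (Fin n → ℚ) → Fin n → ℚ
diff f zero    = f zero
diff f (suc i) = f (suc i) - f (inject₁ i)

diff-cong : ∀ {n} {f g : Fin n → ℚ} → (∀ i → f i ≡ g i) → ∀ i → diff f i ≡ diff g i
diff-cong h zero    = h zero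
diff-cong h (suc i) = cong₂ _-_ (h (suc i)) (h (inject₁ i))

diff-0⇒0 : ∀ {n} {f : Fin n → ℚ} → (∀ i → diff f i ≡ 0ℚ) → ∀ i → f i ≡ 0ℚ
diff-0⇒0 h zero    = h zero
diff-0⇒0 {f = f} h (suc i) = diff-0⇒0 {f = f ∘ suc} tail i
  where
  tail : ∀ i → diff (f ∘ suc) i ≡ 0ℚ
  tail zero    = trans (-≡0⇒≡ (h (suc zero))) (h zero)
  tail (suc i) = h (suc (suc i))

0≤diff⇒0≤ : ∀ {n} {f : Fin n → ℚ} → (∀ i → 0ℚ ≤ diff f i) → ∀ i → 0ℚ ≤ f i
0≤diff⇒0≤ h zero    = h zero
0≤diff⇒0≤ {f = f} h (suc i) = 0≤diff⇒0≤ {f = f ∘ suc} tail i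
  where
  tail : ∀ i → 0ℚ ≤ diff (f ∘ suc) i
  tail zero    = ℚ.≤-trans (h zero) (0≤-⇒≤ (h (suc zero)))
  tail (suc i) = h (suc (suc i))

-- The indicator of an upper set jumps from 0 to 1 at its least element and nowhere else. Hence
-- these indicators form the basis dual to the differences.
diff-upset : ∀ {n} (i j : Fin n) → diff (λ k → [ upset j k ]ℚ) i ≡ δ i j
diff-upset zero    zero    = refl
diff-upset zero    (suc j) = refl
diff-upset (suc i) zero    = refl
diff-upset (suc i) (suc j) = trans (shift i j) (trans (diff-upset i j) (sym (δ-suc i j)))
  where
  shift : ∀ {n} (i j : Fin n) →
          [ upset j i ]ℚ - [ upset (suc j) (inject₁ i) ]ℚ ≡ diff (λ k → [ upset j k ]ℚ) i
  shift zero    j = ℚ.+-identityʳ [ upset j zero ]ℚ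
  shift (suc i) j = refl

⟨-,⟩ : ∀ {d} (u v x : Pt d) → ⟨ (λ k → u k - v k) , x ⟩ ≡ ⟨ u , x ⟩ - ⟨ v , x ⟩
⟨-,⟩ u v x = trans (Σᶠ-cong λ k → solve 3 (λ u v x → (u :- v) :* x := u :* x :- v :* x) refl
  (u k) (v k) (x k)) (Σᶠ-- (λ k → u k * x k) (λ k → v k * x k))

module _ {d n : ℕ} (F : Frame d n) (τ : Permutation′ n) where
  open Frame F

  sortedCov : Fin n → Pt d
  sortedCov i k = diff (λ m → cov (τ ⟨$⟩ˡ m) k) i

  sortedCoord : ∀ i x → ⟨ sortedCov i , x ⟩ ≡ diff (λ m → coord (τ ⟨$⟩ˡ m) x) i
  sortedCoord zero    x = refl
  sortedCoord (suc i) x = ⟨-,⟩ (cov (τ ⟨$⟩ˡ suc i)) (cov (τ ⟨$⟩ˡ inject₁ i)) x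

  -- The barycentre of the face on the indices at position i or later, given by its coordinates and
  -- without reference to a list of rays.
  upsetPoint : Fin n → Pt d
  upsetPoint i = point (λ k → [ upset i (τ ⟨$⟩ʳ k) ]ℚ)

  coord-upsetPoint : ∀ i k → coord k (upsetPoint i) ≡ [ upset i (τ ⟨$⟩ʳ k) ]ℚ
  coord-upsetPoint i = coord-point (λ k → [ upset i (τ ⟨$⟩ʳ k) ]ℚ)

  -- The frame of the cone {0 ≤ y_{τ⁻¹(1)} ≤ … ≤ y_{τ⁻¹(n)}}, y being the coordinates of F.
  sortedFrame : Frame d n
  sortedFrame = record
    { cov      = sortedCov
    ; gen      = upsetPoint
    ; cov-sum  = cov-sum′
    ; dual     = λ i j → trans (sortedCoord i (upsetPoint j)) (trans
        (diff-cong (λ m → trans (coord-upsetPoint j (τ ⟨$⟩ˡ m))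
          (cong ([_]ℚ ∘ upset j) (Perm.inverseʳ τ))) i)
        (diff-upset i j))
    ; faithful = λ x h → faithful x λ i → subst (λ k → coord k x ≡ 0ℚ) (Perm.inverseˡ τ)
        (diff-0⇒0 {f = λ m → coord (τ ⟨$⟩ˡ m) x} (λ j → trans (sym (sortedCoord j x)) (h j))
          (τ ⟨$⟩ʳ i))
    }
    where
    cov-sum′ : ∀ i → Σᶠ (sortedCov i) ≡ 0ℚ
    cov-sum′ zero    = cov-sum (τ ⟨$⟩ˡ zero)
    cov-sum′ (suc i) = trans (Σᶠ-- (cov (τ ⟨$⟩ˡ suc i)) (cov (τ ⟨$⟩ˡ inject₁ i)))
      (cong₂ _-_ (cov-sum (τ ⟨$⟩ˡ suc i)) (cov-sum (τ ⟨$⟩ˡ inject₁ i)))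

  sortedOrthant : ∀ {C : Region d} →
    (∀ x → C x → ∀ i → 0ℚ ≤ diff (λ m → coord (τ ⟨$⟩ˡ m) x) i) →
    (∀ x → (∀ i → 0ℚ ≤ diff (λ m → coord (τ ⟨$⟩ˡ m) x) i) → C x) →
    C ≐ Frame.orthant sortedFrame (Frame.full sortedFrame)
  sortedOrthant to from =
    (λ x Cx i → subst (0ℚ ≤_) (sym (sortedCoord i x)) (to x Cx i) , λ ()) ,
    (λ x ox → from x λ i → subst (0ℚ ≤_) (sortedCoord i x) (proj₁ (ox i)))

-- Up to equality of regions, the cones of S are all the orthants of all the frames F a and nothing
-- else. Two fans with the same presentation therefore coincide.
record Framed {d n} (S : Fan d) {A : Set} (F : A → Frame d n) : Set₁ where
  field
    cone⇒orthant : ∀ s → ∃ λ a → ∃ λ P → cone S s ≐ Frame.orthant (F a) P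
    orthant⇒cone : ∀ a P → ∃ λ s → cone S s ≐ Frame.orthant (F a) P
open Framed

framed-≈Fan : ∀ {d n} {S T : Fan d} {A : Set} {F : A → Frame d n} →
              Framed S F → Framed T F → S ≈Fan T
framed-≈Fan {S = S} {T} {F = F} fS fT = half fS fT , half fT fS
  where
  half : ∀ {S T} → Framed S F → Framed T F → ∀ s → ∃ λ t → cone S s ≐ cone T t
  half fS fT s = let (a , P , S≐) = cone⇒orthant fS s
                     (t , T≐) = orthant⇒cone fT a P in t , ≐-trans S≐ (≐-sym T≐)

withFaces-framed : ∀ {d n} {I A : Set} {σ : I → Region d} {F : A → Frame d n} →
  (∀ i → ∃ λ a → σ i ≐ Frame.orthant (F a) (Frame.full (F a))) →
  (∀ a → ∃ λ i → σ i ≐ Frame.orthant (F a) (Frame.full (F a))) →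
  Framed (withFaces I σ) F
withFaces-framed {F = F} to from = record
  { cone⇒orthant = λ { (lift (i , w , wff)) → let (a , σ≐) = to i in
      a , _ , Frame.face-orthant (F a) w σ≐ wff }
  ; orthant⇒cone = λ a P → let (i , σ≐) = from a in
      lift (i , Frame.cut (F a) P , Frame.cut-isFaceFunctional (F a) P σ≐) ,
      Frame.face-cut (F a) P σ≐
  }

-- Chains of index sets

_⊑_ : ∀ {n} → (Fin n → Bool) → (Fin n → Bool) → Set
P ⊑ Q = ∀ i → P i ≡ true → Q i ≡ true

subset : ∀ {n} {Q : Fin n → Set} → (∀ i → Dec (Q i)) →
         ∃ λ P → ∀ i → (Q i → P i ≡ true) × (P i ≡ true → Q i)
subset Q? = does ∘ Q? , λ i → dec-true (Q? i) , witness (Q? i)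
  where
  witness : ∀ {Q : Set} (Q? : Dec Q) → does Q? ≡ true → Q
  witness (yes q) _ = q

bit : Bool → ℕ
bit b = if b then 1 else 0

bit-mono : ∀ {a b} → (a ≡ true → b ≡ true) → bit a ℕ.≤ bit b
bit-mono {false}         h = z≤n
bit-mono {true}  {b}     h = ℕ.≤-reflexive (cong bit (sym (h refl)))

-- Ordered by the number of members containing them, the indices make every member of a chain
-- an upper set.
count : ∀ {n} → List (Fin n → Bool) → Fin n → ℕ
count []       i = 0
count (P ∷ Ps) i = bit (P i) ℕ.+ count Ps i

count-mono : ∀ {n i j} {Ps : List (Fin n → Bool)} →
             All (λ P → P i ≡ true → P j ≡ true) Ps → count Ps i ℕ.≤ count Ps j
count-mono []       = z≤n
count-mono (h ∷ hs) = ℕ.+-mono-≤ (bit-mono h) (count-mono hs)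

-- Members before P lie inside P and so miss i, members after P contain P and so contain j, and P
-- itself contains j but not i. No member thus favours i, and P favours j strictly.
count-strict : ∀ {n i j} {Ps : List (Fin n → Bool)} {P} → AllPairs _⊑_ Ps → P ∈ Ps →
               P i ≡ false → P j ≡ true → count Ps i ℕ.< count Ps j
count-strict {i = i} {j} {P ∷ Ps} (P⊑ ∷ _) (here refl) Pi Pj rewrite Pi | Pj =
  s≤s (count-mono (All.map (λ P⊑Q _ → P⊑Q j Pj) P⊑))
count-strict {i = i} {j} {Q ∷ Ps} (Q⊑ ∷ ap) (there P∈) Pi Pj = ℕ.+-mono-≤-<
  (bit-mono λ Qi → contradiction (trans (sym (All.lookup Q⊑ P∈ i Qi)) Pi) λ ())
  (count-strict ap P∈ Pi Pj)

Pointwise⇒All : ∀ {a b r t} {A : Set a} {B : Set b} {R : A → B → Set r} {T : A → Set t} {xs ys} →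
                (∀ {x y} → y ∈ ys → R x y → T x) → Pointwise R xs ys → All T xs
Pointwise⇒All h []         = []
Pointwise⇒All h (r ∷ rs) = h (here refl) r ∷ Pointwise⇒All (h ∘ there) rs

module _ {d n : ℕ} (F : Frame d n) where
  open Frame F

  orthant-nonzero : ∀ {C P} → C ≐ orthant P → ¬ (C ≐ zeroCone) → ∃ λ i → P i ≡ true
  orthant-nonzero {C} {P} C≐ C≢0 with any? (λ i → P i Bool.≟ true)
  ... | yes h = h
  ... | no ¬h = contradiction (to , from) C≢0
    where
    to : C ⊆ʳ zeroCone
    to x Cx = down (faithful x λ i → proj₂ (proj₁ C≐ x Cx i) (Bool.¬-not (λ Pi → ¬h (i , Pi))))

    from : zeroCone ⊆ʳ C
    from x x~0 = resp-≈ C-cone (up x~0) (has-0 C-cone)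
      where C-cone = ≐-isConvexCone C≐ (orthant-isConvexCone P)

  coneGen-orthant : ∀ vs Q → All (λ v → ∃ λ m → v ≈ gen m × Q m ≡ true) vs →
    (∀ m → Q m ≡ true → ∃ λ v → v ∈ vs × v ≈ gen m) → coneGen vs ≐ orthant Q
  coneGen-orthant vs Q to from =
    coneGen-minimal (orthant-isConvexCone Q)
      (All.map (λ { (m , v≈g , Qm) → resp-≈ (orthant-isConvexCone Q) v≈g (gen∈orthant Qm) }) to) ,
    orthant-minimal (coneGen-isConvexCone vs) λ m Qm → let (v , v∈ , v≈g) = from m Qm in
      resp-≈ (coneGen-isConvexCone vs) (≈-sym v≈g) (coneGen-∈ v∈)

-- A consequence of the fan axiom that cones meet in common faces: a generator of one maximal cone
-- that lies in another maximal cone is a generator of the latter as well.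
Compatible : ∀ {d n} {A : Set} → (A → Frame d n) → Set
Compatible F = ∀ a b i → (∀ j → 0ℚ ≤ Frame.coord (F b) j (Frame.gen (F a) i)) →
               ∃ λ j → Frame.gen (F a) i ≈ Frame.gen (F b) j

-- By the inclusion every generator in P has nonnegative coordinates in the frame of b, so
-- compatibility matches it with a generator there. `P′` collects the generators that are hit.
orthant-transport : ∀ {d n} {A : Set} {F : A → Frame d n} → Compatible F → ∀ a b {P Q} →
  Frame.orthant (F a) P ⊆ʳ Frame.orthant (F b) Q →
  ∃ λ P′ → Frame.orthant (F a) P ≐ Frame.orthant (F b) P′
orthant-transport {F = F} compat a b {P} ⊆Q = restrict (subset hit?)
  where
  module A = Frame (F a)
  module B = Frame (F b)

  Hit : Fin _ → Set
  Hit j = ∃ λ i → P i ≡ true × A.gen i ≈ B.gen j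

  hit? : ∀ j → Dec (Hit j)
  hit? j = any? λ i → (P i Bool.≟ true) ×-dec (A.gen i B.≈? B.gen j)

  restrict : (∃ λ P′ → ∀ j → (Hit j → P′ j ≡ true) × (P′ j ≡ true → Hit j)) →
             ∃ λ P′ → A.orthant P ≐ B.orthant P′
  restrict (P′ , hit) = P′ ,
    A.orthant-minimal (B.orthant-isConvexCone P′) (λ i Pi →
      let (j , g≈g) = compat a b i λ j → proj₁ (⊆Q (A.gen i) (A.gen∈orthant Pi) j) in
      resp-≈ (B.orthant-isConvexCone P′) g≈g (B.gen∈orthant (proj₁ (hit j) (i , Pi , g≈g)))) ,
    B.orthant-minimal (A.orthant-isConvexCone P) (λ j P′j →
      let (i , Pi , g≈g) = proj₂ (hit j) P′j in
      resp-≈ (A.orthant-isConvexCone P) (≈-sym g≈g) (A.gen∈orthant Pi))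

-- Barycentric subdivision of a framed fan

module _ {d n : ℕ} {A : Set} (L : A → LatticeFrame d n) where
  private
    F : A → Frame d n
    F = LatticeFrame.frame ∘ L

  sortedFrames : A × Permutation′ n → Frame d n
  sortedFrames (a , τ) = sortedFrame (F a) τ

  module _ (S : Fan d) (framed : Framed S F) (compat : Compatible F) (a₀ : A) where

    open ChainElt

    private
      Cone : ChainElt S → Region d
      Cone c = cone S (idx c)

    -- The last cone of the chain contains all the others, so its frame describes the whole chain.
    commonFrame : ∀ cs → Linked (λ c c′ → Cone c ⊊ʳ Cone c′) cs → ∃ λ a → ∃ λ Ps →
      Pointwise (λ c P → Cone c ≐ Frame.orthant (F a) P) cs Ps × AllPairs _⊑_ Ps
    commonFrame []       []  = a₀ , [] , [] , []
    commonFrame (c ∷ []) [-] = let (a , P , C≐) = cone⇒orthant framed (idx c) in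
      a , P ∷ [] , C≐ ∷ [] , [] ∷ []
    commonFrame (c ∷ c′ ∷ cs) ((c⊆c′ , _) ∷ linked) with commonFrame (c′ ∷ cs) linked
    ... | b , Q ∷ Ps , C′≐ ∷ Cs≐ , Q⊑ ∷ Ps⊑ = b , P ∷ Q ∷ Ps , C≐ ∷ C′≐ ∷ Cs≐ ,
      (P⊑Q ∷ All.map (λ Q⊑R i Pi → Q⊑R i (P⊑Q i Pi)) Q⊑) ∷ Q⊑ ∷ Ps⊑
      where
      own = cone⇒orthant framed (idx c)

      moved : ∃ λ P → Frame.orthant (F (proj₁ own)) (proj₁ (proj₂ own)) ≐ Frame.orthant (F b) P
      moved = orthant-transport {F = F} compat (proj₁ own) b {Q = Q} λ x ox →
        proj₁ C′≐ x (c⊆c′ x (proj₂ (proj₂ (proj₂ own)) x ox))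

      P = proj₁ moved

      C≐ : Cone c ≐ Frame.orthant (F b) P
      C≐ = ≐-trans (proj₂ (proj₂ own)) (proj₂ moved)

      P⊑Q : P ⊑ Q
      P⊑Q = Frame.orthant-⊆⁻ (F b) λ x ox → proj₁ C′≐ x (c⊆c′ x (proj₂ C≐ x ox))

    baryPt≈upsetPoint : ∀ a τ m {C P ρ} → C ≐ Frame.orthant (F a) P → IsBaryPt C ρ →
      (∀ k → P k ≡ upset m (τ ⟨$⟩ʳ k)) → ρ ≈ upsetPoint (F a) τ m
    baryPt≈upsetPoint a τ m C≐ isρ P≡ = Frame.coord-injective (F a) λ k →
      trans (coord-baryPt (L a) C≐ isρ k)
        (trans (cong [_]ℚ (P≡ k)) (sym (coord-upsetPoint (F a) τ m k)))

    -- Once the indices are sorted by `count`, each member is a nonempty upper set and its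
    -- barycentre a generator of the sorted frame. Q records which generators occur.
    chain⇒orthant : ∀ s → ∃ λ aτ → ∃ λ Q → cone (Bary S) s ≐ Frame.orthant (sortedFrames aτ) Q
    chain⇒orthant (cs , nonzero , linked) = build (commonFrame cs linked)
      where
      build : (∃ λ a → ∃ λ Ps →
                Pointwise (λ c P → Cone c ≐ Frame.orthant (F a) P) cs Ps × AllPairs _⊑_ Ps) →
              ∃ λ aτ → ∃ λ Q → coneGen (map ρ cs) ≐ Frame.orthant (sortedFrames aτ) Q
      build (a , Ps , Cs≐ , Ps⊑) = (a , τ) , finish (subset hit?)
        where
        τ = proj₁ (sort (count Ps))
        module G = Frame (sortedFrame (F a) τ)

        closed : ∀ {P} → P ∈ Ps → ∀ {i j} → i Fin.≤ j →
                 P (τ ⟨$⟩ˡ i) ≡ true → P (τ ⟨$⟩ˡ j) ≡ true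
        -- A later index outside P would have a strictly smaller `count` than an earlier index
        -- inside P, against the sorting.
        closed {P} P∈ {i} {j} i≤j Pi = true-or-false (P (τ ⟨$⟩ˡ j))
          (λ Pj → contradiction (proj₂ (sort (count Ps)) i≤j)
                                (ℕ.<⇒≱ (count-strict Ps⊑ P∈ Pj Pi)))
          λ h → h

        isGen : ∀ {c P} → P ∈ Ps → Cone c ≐ Frame.orthant (F a) P → ¬ (Cone c ≐ zeroCone) →
                ∃ λ m → ρ c ≈ G.gen m
        isGen {c} {P} P∈ C≐ C≢0 = m ,
          baryPt≈upsetPoint a τ m C≐ (isρ c) λ k → trans (cong P (sym (Perm.inverseˡ τ))) (P≡ (τ ⟨$⟩ʳ k))
          where
          nonempty = orthant-nonzero (F a) C≐ C≢0
          up-set : ∃ λ m → ∀ k → P (τ ⟨$⟩ˡ k) ≡ upset m k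
          up-set = isUpset (λ k → P (τ ⟨$⟩ˡ k)) (closed {P} P∈)
            (τ ⟨$⟩ʳ proj₁ nonempty , trans (cong P (Perm.inverseˡ τ)) (proj₂ nonempty))
          m = proj₁ up-set
          P≡ = proj₂ up-set

        gens : All (λ c → ∃ λ m → ρ c ≈ G.gen m) cs
        gens = All.zipWith (λ { (C≢0 , isG) → isG C≢0 }) (nonzero , Pointwise⇒All (λ {c} → isGen {c}) Cs≐)

        Hit : Fin n → Set
        Hit m = ∃ λ v → v ∈ map ρ cs × v ≈ G.gen m

        hit? : ∀ m → Dec (Hit m)
        hit? m = map′ find (λ { (v , v∈ , v≈) → lose v∈ v≈ })
          (Any.any? (λ v → v G.≈? G.gen m) (map ρ cs))

        finish : (∃ λ Q → ∀ m → (Hit m → Q m ≡ true) × (Q m ≡ true → Hit m)) →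
                 ∃ λ Q → coneGen (map ρ cs) ≐ G.orthant Q
        finish (Q , hit) = Q , coneGen-orthant (sortedFrame (F a) τ) (map ρ cs) Q
          (All.map⁺ (All.zipWith (λ { ((m , ρ≈) , ρ∈) → m , ρ≈ , proj₁ (hit m) (_ , ρ∈ , ρ≈) })
            (gens , All.tabulate (∈-map⁺ ρ))))
          (λ m → proj₂ (hit m))

    -- Each m in Q contributes the face on the positions from m on, whose barycentre is the m-th
    -- generator of the sorted frame.
    orthant⇒chain : ∀ aτ Q → ∃ λ s → cone (Bary S) s ≐ Frame.orthant (sortedFrames aτ) Q
    orthant⇒chain (a , τ) Q =
      (map elt ms , All.map⁺ (All.universal nonzero ms) , linked) , span
      where
      module G₀ = Frame (F a)
      module G  = Frame (sortedFrame (F a) τ)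

      Q? = λ m → Q m Bool.≟ true

      ms : List (Fin n)
      -- The face attached to m shrinks as m grows, so the positions run downwards to make the chain
      -- increase.
      ms = filter Q? (tabulate opposite)

      m∈ms : ∀ {m} → Q m ≡ true → m ∈ ms
      m∈ms {m} Qm = ∈-filter⁺ Q?
        (subst (_∈ tabulate opposite) (Fin.opposite-involutive m) (∈-tabulate⁺ (opposite m))) Qm

      opposite-< : ∀ {i j : Fin n} → i Fin.< j → opposite j Fin.< opposite i
      opposite-< {i} {j} i<j = subst₂ ℕ._<_ (sym (Fin.opposite-prop j)) (sym (Fin.opposite-prop i))
        (ℕ.∸-monoʳ-< (s≤s i<j) (Fin.toℕ<n j))

      U : Fin n → Fin n → Bool
      U m k = upset m (τ ⟨$⟩ʳ k)

      upset-τ : ∀ m k → U m (τ ⟨$⟩ˡ k) ≡ upset m k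
      upset-τ m k = cong (upset m) (Perm.inverseʳ τ)

      elt : Fin n → ChainElt S
      elt m = chainElt (proj₁ (orthant⇒cone framed a (U m)))
        (sumᵖ (map ι (map (LatticeFrame.igen (L a)) (members (L a) (U m)))))
        (orthant-baryPt (L a) (proj₂ (orthant⇒cone framed a (U m))))

      elt≐ : ∀ m → Cone (elt m) ≐ G₀.orthant (U m)
      elt≐ m = proj₂ (orthant⇒cone framed a (U m))

      elt≈ : ∀ m → ρ (elt m) ≈ G.gen m
      elt≈ m = baryPt≈upsetPoint a τ m (elt≐ m) (isρ (elt m)) λ _ → refl

      -- The generator at position m lies in the m-th face and in none with a larger index. It
      -- witnesses both that the face is nonzero and that the inclusions are strict.
      gen∈elt : ∀ m → Cone (elt m) (G₀.gen (τ ⟨$⟩ˡ m))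
      gen∈elt m = proj₂ (elt≐ m) (G₀.gen (τ ⟨$⟩ˡ m))
        (G₀.gen∈orthant {U m} (trans (upset-τ m m) (upset-refl m)))

      gen∉elt : ∀ {i j} → i Fin.< j → ¬ Cone (elt j) (G₀.gen (τ ⟨$⟩ˡ i))
      gen∉elt {i} {j} i<j g∈ = contradiction
        (trans (sym (G₀.gen∈orthant⁻ {U j} (proj₁ (elt≐ j) (G₀.gen (τ ⟨$⟩ˡ i)) g∈)))
          (trans (upset-τ j i) (upset-< i<j))) λ ()

      nonzero : ∀ m → ¬ (Cone (elt m) ≐ zeroCone)
      nonzero m (C⊆0 , _) = G₀.gen≁0 (τ ⟨$⟩ˡ m) (up (C⊆0 (G₀.gen (τ ⟨$⟩ˡ m)) (gen∈elt m)))

      strict : ∀ {i j} → i Fin.< j → Cone (elt j) ⊊ʳ Cone (elt i)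
      strict {i} {j} i<j =
        (λ x Cx → proj₂ (elt≐ i) x λ k → shrink k (proj₁ (elt≐ j) x Cx k)) ,
        λ Ci⊆Cj → gen∉elt i<j (Ci⊆Cj (G₀.gen (τ ⟨$⟩ˡ i)) (gen∈elt i))
        where
        shrink : ∀ k {c} → (0ℚ ≤ c) × (U j k ≡ false → c ≡ 0ℚ) →
                 (0ℚ ≤ c) × (U i k ≡ false → c ≡ 0ℚ)
        shrink k (c≥0 , off) = c≥0 , λ Uik → off (Bool.¬-not λ Ujk → contradiction
          (trans (sym (upset-antitone {i = i} {j} (τ ⟨$⟩ʳ k) (ℕ.<⇒≤ i<j) Ujk)) Uik) λ ())

      linked : Linked (λ c c′ → Cone c ⊊ʳ Cone c′) (map elt ms)
      linked = AllPairs⇒Linked (AllPairs.map⁺ {R = λ c c′ → Cone c ⊊ʳ Cone c′} {f = elt}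
        (AllPairs.filter⁺ Q? (AllPairs.tabulate⁺-< λ {i} {j} i<j → strict (opposite-< i<j))))

      hit : ∀ {ms} → All (λ m → Q m ≡ true) ms →
            All (λ v → ∃ λ m → v ≈ G.gen m × Q m ≡ true) (map ρ (map elt ms))
      hit []                   = []
      hit (_∷_ {m} Qm Qms) = (m , elt≈ m , Qm) ∷ hit Qms

      span : coneGen (map ρ (map elt ms)) ≐ G.orthant Q
      span = coneGen-orthant (sortedFrame (F a) τ) (map ρ (map elt ms)) Q
        (hit (All.all-filter Q? (tabulate opposite)))
        (λ m Qm → ρ (elt m) , ∈-map⁺ ρ (∈-map⁺ elt (m∈ms Qm)) , elt≈ m)

    bary-framed : Framed (Bary S) sortedFrames
    bary-framed = record { cone⇒orthant = chain⇒orthant ; orthant⇒cone = orthant⇒chain }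

-- Rays and barycentres depend on a cone only as a set of points, so a chain is carried over with
-- the same vectors and generates the same cone. This allows a fan to be replaced by an equal one
-- under a second subdivision.
bary-≈Fan : ∀ {d} {S T : Fan d} → S ≈Fan T → Bary S ≈Fan Bary T
bary-≈Fan (to , from) = half to , half from
  where
  half : ∀ {S T} → (∀ s → ∃ λ t → cone S s ≐ cone T t) →
         ∀ s → ∃ λ t → cone (Bary S) s ≐ cone (Bary T) t
  half {S} {T} to (cs , nonzero , linked) =
    (map move cs ,
     All.map⁺ (All.map (λ {c} C≢0 D≐0 → C≢0 (≐-trans (moved c) D≐0)) nonzero) ,
     move-linked linked) ,
    subst (λ vs → coneGen (map ChainElt.ρ cs) ≐ coneGen vs) (move-ρ cs) ≐-refl
    where
    open ChainElt

    moved : ∀ c → cone S (idx c) ≐ cone T (proj₁ (to (idx c)))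
    moved c = proj₂ (to (idx c))

    isBaryPt-≐ : ∀ {C D ρ} → C ≐ D → IsBaryPt C ρ → IsBaryPt D ρ
    isBaryPt-≐ C≐D (gs , rays , complete , distinct , eq) = gs ,
      All.map (λ { (R , R-ray , prim) → R , isRayOf-≐ C≐D R-ray , prim }) rays ,
      (λ R R-ray → complete R (isRayOf-≐ (≐-sym C≐D) R-ray)) , distinct , eq
      where
      isRayOf-≐ : ∀ {C D R} → C ≐ D → IsRayOf C R → IsRayOf D R
      isRayOf-≐ (C⊆D , D⊆C) ((w , (Σw≡0 , w≥0) , (R⊆ , ⊆R)) , isRay) =
        (w , (Σw≡0 , λ x Dx → w≥0 x (D⊆C x Dx)) ,
          (λ x Rx → C⊆D x (proj₁ (R⊆ x Rx)) , proj₂ (R⊆ x Rx)) ,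
          (λ x Dx → ⊆R x (D⊆C x (proj₁ Dx) , proj₂ Dx))) , isRay

    move : ChainElt S → ChainElt T
    move c = chainElt (proj₁ (to (idx c))) (ρ c) (isBaryPt-≐ (moved c) (isρ c))

    move-⊊ : ∀ {c c′} → cone S (idx c) ⊊ʳ cone S (idx c′) →
             cone T (idx (move c)) ⊊ʳ cone T (idx (move c′))
    move-⊊ {c} {c′} (C⊆C′ , C′⊈C) =
      (λ x Dx → proj₁ (moved c′) x (C⊆C′ x (proj₂ (moved c) x Dx))) ,
      λ D′⊆D → C′⊈C λ x C′x → proj₂ (moved c) x (D′⊆D x (proj₁ (moved c′) x C′x))

    move-linked : ∀ {cs} → Linked (λ c c′ → cone S (idx c) ⊊ʳ cone S (idx c′)) cs →
                  Linked (λ c c′ → cone T (idx c) ⊊ʳ cone T (idx c′)) (map move cs)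
    move-linked []            = []
    move-linked [-]           = [-]
    move-linked (_∷_ {c} {c′} c⊊c′ rest) = move-⊊ {c} {c′} c⊊c′ ∷ move-linked rest

    move-ρ : ∀ cs → map ρ cs ≡ map ρ (map move cs)
    move-ρ []       = refl
    move-ρ (c ∷ cs) = cong (ρ c ∷_) (move-ρ cs)

-- The Braid fan and the normal fan of the simplex

⟨e,⟩ : ∀ {d} p (x : Pt d) → ⟨ e p , x ⟩ ≡ x p
⟨e,⟩ p x = trans (Σᶠ-cong λ k → cong (_* x k) (e≡δ p k)) (Σᶠ-δ p x)

⟨,e⟩ : ∀ {d} p (w : Pt d) → ⟨ w , e p ⟩ ≡ w p
⟨,e⟩ p w = trans (Σᶠ-cong λ k → ℚ.*-comm (w k) (e p k)) (⟨e,⟩ p w)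

Σᶠ-e : ∀ {d} (p : Fin (suc d)) → Σᶠ (e p) ≡ 1ℚ
Σᶠ-e p = trans (Σᶠ-cong λ k → sym (ℚ.*-identityʳ (e p k))) (⟨e,⟩ p λ _ → 1ℚ)

module _ {d : ℕ} (p q : Fin (suc d)) where

  gap : Pt d
  gap k = e p k - e q k

  ⟨gap,⟩ : ∀ x → ⟨ gap , x ⟩ ≡ x p - x q
  ⟨gap,⟩ x = trans (⟨-,⟩ (e p) (e q) x) (cong₂ _-_ (⟨e,⟩ p x) (⟨e,⟩ q x))

  gap-sum : Σᶠ gap ≡ 0ℚ
  gap-sum = trans (Σᶠ-- (e p) (e q)) (cong₂ _-_ (Σᶠ-e p) (Σᶠ-e q))

  gap-int : ∀ u → ∃ λ z → ⟨ gap , ι u ⟩ ≡ z / 1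
  gap-int u = u p ℤ.- u q , trans (⟨gap,⟩ (ι u)) (sym (/1-homo-- (u p) (u q)))

constant : ∀ {n} {f : Fin (suc n) → ℚ} → (∀ i → f (suc i) ≡ f (inject₁ i)) → ∀ m → f m ≡ f zero
constant h zero = refl
constant {suc n} {f} h (suc m) = trans (constant {f = f ∘ suc} (h ∘ suc) m) (h zero)

monotone : ∀ {n} {f : Fin (suc n) → ℚ} → (∀ i → f (inject₁ i) ≤ f (suc i)) →
           ∀ {i j} → i Fin.≤ j → f i ≤ f j
monotone h {zero} {zero} _ = ℚ.≤-refl
monotone {suc n} {f} h {zero} {suc j} _ = ℚ.≤-trans (h zero)
  (monotone {f = f ∘ suc} (h ∘ suc) {zero} {j} z≤n)
monotone {suc n} {f} h {suc i} {suc j} (s≤s i≤j) = monotone {f = f ∘ suc} (h ∘ suc) i≤j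

module _ {d : ℕ} (π : Permutation′ (suc d)) where

  private
    -- The shift to `suc i` omits the upper set starting at position zero: its indicator is the
    -- all-one vector, which is zero in W_d.
    up-indicator : Fin d → Pt d
    up-indicator i k = [ upset (suc i) (π ⟨$⟩ʳ k) ]ℚ

  Δ-cov : Fin d → Pt d
  Δ-cov i = gap (π ⟨$⟩ˡ suc i) (π ⟨$⟩ˡ inject₁ i)

  ⟨Δ-cov,⟩ : ∀ i x → ⟨ Δ-cov i , x ⟩ ≡ Δ π x i
  ⟨Δ-cov,⟩ i x = ⟨gap,⟩ (π ⟨$⟩ˡ suc i) (π ⟨$⟩ˡ inject₁ i) x

  brFrame : LatticeFrame d d
  brFrame = record
    { frame = record
      { cov = Δ-cov
      ; gen = up-indicator
      ; cov-sum = λ i → gap-sum (π ⟨$⟩ˡ suc i) (π ⟨$⟩ˡ inject₁ i)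
      ; dual = λ i j → trans (⟨Δ-cov,⟩ i (up-indicator j)) (trans
          (cong₂ (λ a b → [ upset (suc j) a ]ℚ - [ upset (suc j) b ]ℚ)
            (Perm.inverseʳ π) (Perm.inverseʳ π))
          (trans (diff-upset (suc i) (suc j)) (δ-suc i j)))
      ; faithful = λ x h → up (x (π ⟨$⟩ˡ zero) , λ k → trans (cong x (sym (Perm.inverseˡ π)))
          (trans (constant {f = λ m → x (π ⟨$⟩ˡ m)}
              (λ i → -≡0⇒≡ (trans (sym (⟨Δ-cov,⟩ i x)) (h i))) (π ⟨$⟩ʳ k))
            (sym (ℚ.+-identityˡ (x (π ⟨$⟩ˡ zero))))))
      }
    ; igen    = λ i k → if upset (suc i) (π ⟨$⟩ʳ k) then 1ℤ else 0ℤ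
    ; ι-igen  = λ i → ≗⇒≈ λ k → cast-bit (upset (suc i) (π ⟨$⟩ʳ k))
    ; cov-int = λ i → gap-int (π ⟨$⟩ˡ suc i) (π ⟨$⟩ˡ inject₁ i)
    }
    where
    cast-bit : ∀ b → (if b then 1ℤ else 0ℤ) / 1 ≡ [ b ]ℚ
    cast-bit true  = refl
    cast-bit false = refl

  private
    F = LatticeFrame.frame brFrame

  σBr-orthant : σBr π ≐ Frame.orthant F (Frame.full F)
  σBr-orthant =
    (λ x h i → subst (0ℚ ≤_) (sym (⟨Δ-cov,⟩ i x)) (≤⇒0≤- (h i)) , λ ()) ,
    (λ x o i → 0≤-⇒≤ (subst (0ℚ ≤_) (⟨Δ-cov,⟩ i x) (proj₁ (o i))))

-- The sorted frame asks only the smallest difference to be nonnegative, `σBr` all of them; the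
-- others follow because the differences increase along τ.
σBr²-orthant : ∀ {d} (π : Permutation′ (suc d)) τ →
  let G = sortedFrame (LatticeFrame.frame (brFrame π)) τ in
  σBr² (π , τ) ≐ Frame.orthant G (Frame.full G)
σBr²-orthant {zero}  π τ = sortedOrthant (LatticeFrame.frame (brFrame π)) τ (λ _ _ ()) (λ _ _ ())
σBr²-orthant {suc d} π τ = sortedOrthant F τ to from
  where
  F = LatticeFrame.frame (brFrame π)
  open Frame F using (coord)

  to : ∀ x → σBr² (π , τ) x → ∀ i → 0ℚ ≤ diff (λ m → coord (τ ⟨$⟩ˡ m) x) i
  to x (σx , _)      zero    = proj₁ (proj₁ (σBr-orthant π) x σx (τ ⟨$⟩ˡ zero))
  to x (_  , sorted) (suc i) = ≤⇒0≤- (subst₂ _≤_ (sym (⟨Δ-cov,⟩ π (τ ⟨$⟩ˡ inject₁ i) x))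
    (sym (⟨Δ-cov,⟩ π (τ ⟨$⟩ˡ suc i) x)) (sorted i))

  from : ∀ x → (∀ i → 0ℚ ≤ diff (λ m → coord (τ ⟨$⟩ˡ m) x) i) → σBr² (π , τ) x
  from x h =
    proj₂ (σBr-orthant π) x (λ i → subst (λ k → 0ℚ ≤ coord k x) (Perm.inverseˡ τ)
      (0≤diff⇒0≤ {f = λ m → coord (τ ⟨$⟩ˡ m) x} h (τ ⟨$⟩ʳ i)) , λ ()) ,
    λ i → subst₂ _≤_ (⟨Δ-cov,⟩ π (τ ⟨$⟩ˡ inject₁ i) x) (⟨Δ-cov,⟩ π (τ ⟨$⟩ˡ suc i) x)
      (0≤-⇒≤ (h (suc i)))

-- Lying in the cone of b makes the 0/1 vector g monotone along the order of b, so its support is an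
-- upper set there. The support is nonempty and proper, and such indicators are the generators at b.
brFrame-compatible : ∀ {d} → Compatible (LatticeFrame.frame ∘ brFrame {d})
brFrame-compatible {d} a b i g≥0 = from-upset (isUpset B closed
  (b ⟨$⟩ʳ (a ⟨$⟩ˡ suc i) , trans (B≡ (suc i)) (upset-refl (suc i))))
  where
  B : Fin (suc d) → Bool
  B m = upset (suc i) (a ⟨$⟩ʳ (b ⟨$⟩ˡ m))

  B≡ : ∀ m → B (b ⟨$⟩ʳ (a ⟨$⟩ˡ m)) ≡ upset (suc i) m
  B≡ m = cong (upset (suc i)) (trans (cong (a ⟨$⟩ʳ_) (Perm.inverseˡ b)) (Perm.inverseʳ a))

  g : Pt d
  g = Frame.gen (LatticeFrame.frame (brFrame a)) i

  1≰0 : ¬ (1ℚ ≤ 0ℚ)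
  1≰0 1≤0 = 1≢0 (ℚ.≤-antisym 1≤0 0≤1)

  closed : ∀ {m m′} → m Fin.≤ m′ → B m ≡ true → B m′ ≡ true
  closed {m} {m′} m≤m′ Bm = true-or-false (B m′)
    (λ Bm′ → contradiction
      (subst₂ (λ s t → [ s ]ℚ ≤ [ t ]ℚ) Bm Bm′
        (monotone {f = λ k → [ B k ]ℚ}
          (λ j → 0≤-⇒≤ (subst (0ℚ ≤_) (⟨Δ-cov,⟩ b j g) (g≥0 j))) m≤m′))
      1≰0)
    λ h → h

  from-upset : (∃ λ m → ∀ k → B k ≡ upset m k) →
               ∃ λ j → g ≈ Frame.gen (LatticeFrame.frame (brFrame b)) j
  -- Here the support would be everything, yet the first entry in the order of a is missing from it.
  from-upset (zero  , h) = contradiction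
    (trans (sym (B≡ zero)) (h (b ⟨$⟩ʳ (a ⟨$⟩ˡ zero)))) λ ()
  from-upset (suc j , h) = j , ≗⇒≈ λ k → cong [_]ℚ
    (trans (cong (upset (suc i) ∘ (a ⟨$⟩ʳ_)) (sym (Perm.inverseˡ b))) (h (b ⟨$⟩ʳ k)))

brFrames : ∀ {d} → Permutation′ (suc d) → Frame d d
brFrames π = LatticeFrame.frame (brFrame π)

Br-framed : ∀ d → Framed (Br d) brFrames
Br-framed d = withFaces-framed (λ π → π , σBr-orthant π) (λ π → π , σBr-orthant π)

Br²-framed : ∀ d → Framed (Br² d) (sortedFrames brFrame)
Br²-framed d = withFaces-framed (λ { (π , τ) → (π , τ) , σBr²-orthant π τ })
  (λ { (π , τ) → (π , τ) , σBr²-orthant π τ })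

Br²-≈-Bary-Br : ∀ d → Br² d ≈Fan Bary (Br d)
Br²-≈-Bary-Br d = framed-≈Fan (Br²-framed d)
  -- The last argument is a default: it names the frame in which the empty chain, that is the zero
  -- cone, is written.
  (bary-framed brFrame (Br d) (Br-framed d) brFrame-compatible Perm.id)

-- The normal fan of the simplex

split : ∀ {n} (p k : Fin (suc n)) → k ≡ p ⊎ ∃ λ j → k ≡ punchIn p j
split p k with p ≟ k
... | yes p≡k = inj₁ (sym p≡k)
... | no  p≢k = inj₂ (Fin.punchOut p≢k , sym (Fin.punchIn-punchOut p≢k))

module _ {d : ℕ} (p : Fin (suc d)) where

  private
    neg-e : Fin d → Pt d
    neg-e j k = - δ (punchIn p j) k

  top-cov : Fin d → Pt d
  top-cov j = gap p (punchIn p j)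

  ⟨top-cov,⟩ : ∀ j x → ⟨ top-cov j , x ⟩ ≡ x p - x (punchIn p j)
  ⟨top-cov,⟩ j = ⟨gap,⟩ p (punchIn p j)

  -- The normal cone at the vertex `e p`: the entry at p is maximal, and modulo constants the cone
  -- is spanned by the vectors obtained by lowering one other entry.
  nfFrame : LatticeFrame d d
  nfFrame = record
    { frame = record
      { cov = top-cov
      ; gen = neg-e
      ; cov-sum = λ j → gap-sum p (punchIn p j)
      ; dual = λ i j → trans (⟨top-cov,⟩ i (neg-e j)) (dual i j)
      ; faithful = λ x h → up (x p , λ k → trans (constant-at x h k (split p k))
          (sym (ℚ.+-identityˡ (x p))))
      }
    ; igen    = λ j k → if does (punchIn p j ≟ k) then -1ℤ else 0ℤ
    ; ι-igen  = λ j → ≗⇒≈ λ k → cast-neg-bit (does (punchIn p j ≟ k))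
    ; cov-int = λ j → gap-int p (punchIn p j)
    }
    where
    cast-neg-bit : ∀ b → (if b then -1ℤ else 0ℤ) / 1 ≡ - [ b ]ℚ
    cast-neg-bit true  = refl
    cast-neg-bit false = refl

    dual : ∀ i j → - δ (punchIn p j) p - - δ (punchIn p j) (punchIn p i) ≡ δ i j
    dual i j = begin
      - δ (punchIn p j) p - - δ (punchIn p j) (punchIn p i)
        ≡⟨ cong (λ s → - s - - δ (punchIn p j) (punchIn p i)) (δ-≢ (Fin.punchInᵢ≢i p j)) ⟩
      - 0ℚ - - δ (punchIn p j) (punchIn p i)
        ≡⟨ solve 1 (λ s → (:- con 0ℚ) :- (:- s) := s) refl (δ (punchIn p j) (punchIn p i)) ⟩
      δ (punchIn p j) (punchIn p i)              ≡⟨ δ-punchIn (j ≟ i) ⟩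
      δ j i                                      ≡⟨ δ-sym j i ⟩
      δ i j                                      ∎
      where
      open ≡-Reasoning
      δ-punchIn : Dec (j ≡ i) → δ (punchIn p j) (punchIn p i) ≡ δ j i
      δ-punchIn (yes refl) = trans (δ-refl (punchIn p j)) (sym (δ-refl j))
      δ-punchIn (no j≢i)   = trans (δ-≢ (j≢i ∘ Fin.punchIn-injective p j i)) (sym (δ-≢ j≢i))

    constant-at : ∀ x → (∀ j → ⟨ top-cov j , x ⟩ ≡ 0ℚ) →
                  ∀ k → k ≡ p ⊎ (∃ λ j → k ≡ punchIn p j) → x k ≡ x p
    constant-at x h k (inj₁ refl)       = refl
    constant-at x h k (inj₂ (j , refl)) = sym (-≡0⇒≡ (trans (sym (⟨top-cov,⟩ j x)) (h j)))

nfFrames : ∀ {d} → Fin (suc d) → Frame d d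
nfFrames p = LatticeFrame.frame (nfFrame p)

-- Every generator lowers a single entry. If that entry is b, all coordinates in the frame at b
-- equal -1, which nonnegativity excludes; otherwise the vector is itself a generator at b.
nfFrame-compatible : ∀ {d} → Compatible (nfFrames {d})
nfFrame-compatible a b i g≥0 with split b (punchIn a i)
... | inj₂ (j , eq) = j , ≗⇒≈ λ k → cong (λ q → - δ q k) eq
... | inj₁ eq = contradiction (ℚ.≤-antisym 0≤-1 (ℚ.neg-antimono-≤ 0≤1)) λ ()
  where
  0≤-1 : 0ℚ ≤ - 1ℚ
  0≤-1 = subst (0ℚ ≤_) (begin
    ⟨ top-cov b i , (λ k → - δ (punchIn a i) k) ⟩
      ≡⟨ ⟨top-cov,⟩ b i (λ k → - δ (punchIn a i) k) ⟩
    - δ (punchIn a i) b - - δ (punchIn a i) (punchIn b i)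
      ≡⟨ cong (λ q → - δ q b - - δ q (punchIn b i)) eq ⟩
    - δ b b - - δ b (punchIn b i)
      ≡⟨ cong₂ (λ s t → - s - - t) (δ-refl b) (δ-≢ (Fin.punchInᵢ≢i b i ∘ sym)) ⟩
    - 1ℚ ∎) (g≥0 i)
    where open ≡-Reasoning

module _ {d : ℕ} where

  e∈simplex : ∀ p → stdSimplex d (e p)
  e∈simplex p = δ p , (λ j → 0≤[ does (p ≟ j) ]) ,
    trans (Σᶠ-cong λ j → sym (e≡δ p j)) (Σᶠ-e p) ,
    λ i → sym (Σᶠ-δ p λ j → e j i)

  ⟨,simplex⟩ : ∀ (w x l : Pt d) → (∀ i → x i ≡ Σᶠ (λ j → l j * e j i)) →
               ⟨ w , x ⟩ ≡ Σᶠ (λ j → l j * w j)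
  ⟨,simplex⟩ w x l x≡ = begin
    ⟨ w , x ⟩                                  ≡⟨ Σᶠ-cong (λ k → cong (w k *_) (x≡ k)) ⟩
    ⟨ w , (λ k → Σᶠ (λ j → l j * e j k)) ⟩     ≡⟨ ⟨⟩-Σᶠ w (λ j → l j · e j) ⟩
    Σᶠ (λ j → ⟨ w , l j · e j ⟩)
      ≡⟨ Σᶠ-cong (λ j → trans (⟨⟩-· w (l j) (e j)) (cong (l j *_) (⟨,e⟩ j w))) ⟩
    Σᶠ (λ j → l j * w j)                       ∎
    where open ≡-Reasoning

  -- M − ⟨w,x⟩ as a combination of terms that are nonnegative when M bounds w; only maximal
  -- entries of w carry weight when it vanishes.
  deficit : ∀ (w x : Pt d) M → ((l , _) : stdSimplex d x) →
            M - ⟨ w , x ⟩ ≡ Σᶠ (λ j → l j * (M - w j))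
  deficit w x M (l , _ , Σl≡1 , x≡) = begin
    M - ⟨ w , x ⟩
      ≡⟨ cong₂ _-_ (sym (trans (cong (M *_) Σl≡1) (ℚ.*-identityʳ M))) (⟨,simplex⟩ w x l x≡) ⟩
    M * Σᶠ l - Σᶠ (λ j → l j * w j)
      ≡⟨ cong (_- Σᶠ (λ j → l j * w j)) (sym (Σᶠ-* M l)) ⟩
    Σᶠ (λ j → M * l j) - Σᶠ (λ j → l j * w j)
      ≡⟨ sym (Σᶠ-- (λ j → M * l j) (λ j → l j * w j)) ⟩
    Σᶠ (λ j → M * l j - l j * w j)
      ≡⟨ Σᶠ-cong (λ j → solve 3 (λ M l w → M :* l :- l :* w := l :* (M :- w)) refl M (l j) (w j)) ⟩
    Σᶠ (λ j → l j * (M - w j)) ∎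
    where open ≡-Reasoning

  simplex-≤ : ∀ (w x : Pt d) M → (∀ k → w k ≤ M) → stdSimplex d x → ⟨ w , x ⟩ ≤ M
  simplex-≤ w x M w≤M x∈ = 0≤-⇒≤ (subst (0ℚ ≤_) (sym (deficit w x M x∈))
    (0≤Σᶠ λ j → 0≤* (proj₁ (proj₂ x∈) j) (≤⇒0≤- (w≤M j))))

  module _ (w : Pt d) (p : Fin (suc d)) (w≤wp : ∀ k → w k ≤ w p) where

    open Frame (nfFrames p) using (coord; orthant)

    -- The face maximising w is spanned by the vertices where w is largest. A normal vector v must
    -- attain its own maximum at each of them, but may be smaller elsewhere, so the nonmaximal
    -- entries of w index the free coordinates.
    nonMaximal : Fin d → Bool
    nonMaximal j = not (does (coord j w ℚ.≟ 0ℚ))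

    e∈maxFace : ∀ q → w q ≡ w p → maxFace (stdSimplex d) w (e q)
    e∈maxFace q wq≡wp = e∈simplex q , λ y y∈ →
      subst (⟨ w , y ⟩ ≤_) (sym (trans (⟨,e⟩ q w) wq≡wp)) (simplex-≤ w y (w p) w≤wp y∈)

    compare : ∀ v → normalCone (stdSimplex d) (maxFace (stdSimplex d) w) v →
              ∀ q → w q ≡ w p → ∀ r → v r ≤ v q
    compare v v∈ q wq≡wp r = subst₂ _≤_ (⟨,e⟩ r v) (⟨,e⟩ q v)
      (v∈ (e q) (e r) (e∈maxFace q wq≡wp) (e∈simplex r))

    maximal : ∀ j → nonMaximal j ≡ false → w (punchIn p j) ≡ w p
    maximal j h = sym (-≡0⇒≡ (trans (sym (⟨top-cov,⟩ p j w)) (zero? (coord j w) h)))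
      where
      zero? : ∀ c → not (does (c ℚ.≟ 0ℚ)) ≡ false → c ≡ 0ℚ
      zero? c h with c ℚ.≟ 0ℚ
      ... | yes c≡0 = c≡0

    nonMaximal⁺ : ∀ j → w (punchIn p j) ≡ w p → nonMaximal j ≡ false
    nonMaximal⁺ j eq = cong not (dec-true (coord j w ℚ.≟ 0ℚ)
      (trans (⟨top-cov,⟩ p j w) (trans (cong (λ s → w p - s) eq) (ℚ.+-inverseʳ (w p)))))

    normalCone-orthant : normalCone (stdSimplex d) (maxFace (stdSimplex d) w) ≐ orthant nonMaximal
    normalCone-orthant = to , from
      where
      to : normalCone (stdSimplex d) (maxFace (stdSimplex d) w) ⊆ʳ orthant nonMaximal
      to v v∈ j =
        subst (0ℚ ≤_) (sym (⟨top-cov,⟩ p j v)) (≤⇒0≤- (compare v v∈ p refl (punchIn p j))) ,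
        λ h → trans (⟨top-cov,⟩ p j v) (trans
          (cong (λ s → s - v (punchIn p j))
            (ℚ.≤-antisym (compare v v∈ (punchIn p j) (maximal j h) p)
                         (compare v v∈ p refl (punchIn p j))))
          (ℚ.+-inverseʳ (v (punchIn p j))))

      from : orthant nonMaximal ⊆ʳ normalCone (stdSimplex d) (maxFace (stdSimplex d) w)
      from v ov x y (x∈@(l , l≥0 , _) , x-max) y∈ =
        -- The value of v at x is `v p`: x puts weight only on maximal entries of w, where v takes
        -- the value `v p`.
        subst (⟨ v , y ⟩ ≤_) (-≡0⇒≡ (trans (deficit v x (v p) x∈) (Σᶠ-zero v-term)))
          (simplex-≤ v y (v p) v≤vp y∈)
        where
        v≤vp : ∀ k → v k ≤ v p
        v≤vp k with split p k
        ... | inj₁ refl       = ℚ.≤-refl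
        ... | inj₂ (j , refl) = 0≤-⇒≤ (subst (0ℚ ≤_) (⟨top-cov,⟩ p j v) (proj₁ (ov j)))

        w-term : ∀ k → l k * (w p - w k) ≡ 0ℚ
        -- Comparison of x with the vertex `e p` shows that x has deficit zero with respect to
        -- `w p`, so each nonnegative term vanishes.
        w-term = Σᶠ≡0⇒≡0 (λ k → 0≤* (l≥0 k) (≤⇒0≤- (w≤wp k))) (begin
          Σᶠ (λ k → l k * (w p - w k))   ≡⟨ deficit w x (w p) x∈ ⟨
          w p - ⟨ w , x ⟩
            ≡⟨ cong (λ s → w p - s) (ℚ.≤-antisym (simplex-≤ w x (w p) w≤wp x∈)
                 (subst (_≤ ⟨ w , x ⟩) (⟨,e⟩ p w) (x-max (e p) (e∈simplex p)))) ⟩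
          w p - w p                      ≡⟨ ℚ.+-inverseʳ (w p) ⟩
          0ℚ                             ∎)
          where open ≡-Reasoning

        v-term : ∀ k → l k * (v p - v k) ≡ 0ℚ
        v-term k with split p k
        ... | inj₁ refl = trans (cong (l p *_) (ℚ.+-inverseʳ (v p))) (ℚ.*-zeroʳ (l p))
        ... | inj₂ (j , refl) = true-or-false (nonMaximal j)
          (λ h → trans (cong (l (punchIn p j) *_) (trans (sym (⟨top-cov,⟩ p j v)) (proj₂ (ov j) h)))
            (ℚ.*-zeroʳ (l (punchIn p j))))
          (λ h → trans (cong (_* (v p - v (punchIn p j))) (*≡0⇒≡0
              (λ gap≡0 → contradiction
                (trans (sym h) (nonMaximal⁺ j (sym (-≡0⇒≡ gap≡0)))) λ ())
              (trans (ℚ.*-comm (w p - w (punchIn p j)) (l (punchIn p j))) (w-term (punchIn p j)))))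
            (ℚ.*-zeroˡ (v p - v (punchIn p j))))

NormalFan-framed : ∀ d → Framed (NormalFan (stdSimplex d)) nfFrames
NormalFan-framed d = record
  { cone⇒orthant = λ { (lift w) → argmax w , nonMaximal w (argmax w) (w≤max w) ,
      normalCone-orthant w (argmax w) (w≤max w) }
  ; orthant⇒cone = λ p P → lift (witness p P) ,
      ≐-trans (normalCone-orthant (witness p P) p (witness≤ p P))
        (Frame.orthant-cong (nfFrames p) λ j → trans
          (cong not (≟0-[not] (not (P j)) (trans (Frame.coord-point (nfFrames p) (λ i → [ P i ]ℚ) j)
            (cong [_]ℚ (sym (Bool.not-involutive (P j)))))))
          (Bool.not-involutive (P j)))
  }
  where
  argmax : Pt d → Fin (suc d)
  argmax w = ℚ-Extrema.argmax w zero (allFin (suc d))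

  w≤max : ∀ w k → w k ≤ w (argmax w)
  w≤max w k = All.lookup (ℚ-Extrema.f[xs]≤f[argmax] {f = w} zero (allFin (suc d))) (∈-allFin k)

  -- The sum of the generators in P, a point in the relative interior of the orthant: exactly the
  -- entries indexed by P fall below the one at p.
  witness : Fin (suc d) → (Fin d → Bool) → Pt d
  witness p P = Frame.point (nfFrames p) λ j → [ P j ]ℚ

  witness≤ : ∀ p P k → witness p P k ≤ witness p P p
  witness≤ p P k with split p k
  ... | inj₁ refl       = ℚ.≤-refl
  ... | inj₂ (j , refl) = 0≤-⇒≤ (subst (0ℚ ≤_)
    (trans (sym (Frame.coord-point (nfFrames p) (λ j → [ P j ]ℚ) j)) (⟨top-cov,⟩ p j (witness p P)))
    0≤[ P j ])

-- The Braid fan as a subdivision of the normal fan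

opposite-inject₁ : ∀ {n} (i : Fin n) → opposite (inject₁ i) ≡ suc (opposite i)
opposite-inject₁ zero    = refl
opposite-inject₁ (suc i) = cong inject₁ (opposite-inject₁ i)

-- In the frame at p = π⁻¹(d+1) the coordinates of x are the distances from x_p; they increase
-- along the other entries listed in decreasing order.
σBr-sorted : ∀ {d} (π : Permutation′ (suc d)) p (τ : Permutation′ d) →
  π ⟨$⟩ˡ opposite zero ≡ p → (∀ m → π ⟨$⟩ˡ opposite (suc m) ≡ punchIn p (τ ⟨$⟩ˡ m)) →
  let G = sortedFrame (nfFrames p) τ in σBr π ≐ Frame.orthant G (Frame.full G)
σBr-sorted {d} π p τ first rest = sortedOrthant (nfFrames p) τ
  (λ x σx i → subst (0ℚ ≤_) (sym (step x i)) (≤⇒0≤- (descend x σx i)))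
  (λ x h i → ascend x i (λ j → 0≤-⇒≤ (subst (0ℚ ≤_) (step x j) (h j))))
  where
  r : Fin (suc d) → Fin (suc d)
  r m = π ⟨$⟩ˡ opposite m

  coords : Pt d → Fin d → ℚ
  coords x m = Frame.coord (nfFrames p) (τ ⟨$⟩ˡ m) x

  coords≡ : ∀ x m → coords x m ≡ x p - x (r (suc m))
  coords≡ x m = trans (⟨top-cov,⟩ p (τ ⟨$⟩ˡ m) x) (cong (λ q → x p - x q) (sym (rest m)))

  step : ∀ x i → diff (coords x) i ≡ x (r (inject₁ i)) - x (r (suc i))
  step x zero    = trans (coords≡ x zero) (cong (λ q → x q - x (r (suc zero))) (sym first))
  step x (suc i) = trans (cong₂ _-_ (coords≡ x (suc i)) (coords≡ x (inject₁ i)))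
    (solve 3 (λ a b c → (a :- b) :- (a :- c) := c :- b) refl
      (x p) (x (r (suc (suc i)))) (x (r (inject₁ (suc i)))))

  descend : ∀ x → σBr π x → ∀ i → x (r (suc i)) ≤ x (r (inject₁ i))
  descend x σx i = subst (λ k → x (r (suc i)) ≤ x (π ⟨$⟩ˡ k)) (sym (opposite-inject₁ i))
    (σx (opposite i))

  ascend : ∀ x i → (∀ j → x (r (suc j)) ≤ x (r (inject₁ j))) →
           x (π ⟨$⟩ˡ inject₁ i) ≤ x (π ⟨$⟩ˡ suc i)
  ascend x i h = subst (λ k → x (π ⟨$⟩ˡ inject₁ k) ≤ x (π ⟨$⟩ˡ suc k)) (Fin.opposite-involutive i)
    (subst (λ k → x (r (suc (opposite i))) ≤ x (π ⟨$⟩ˡ k)) (opposite-inject₁ (opposite i))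
      (h (opposite i)))

-- An ordering of d+1 entries amounts to the choice of the top entry p and an ordering of the
-- others; removing and inserting position zero pass between the two. R lists the entries from the
-- top down, because the coordinates at p grow as the entries fall.
Br-framed-sorted : ∀ d → Framed (Br d) (sortedFrames nfFrame)
Br-framed-sorted d = withFaces-framed to from
  where
  to : ∀ π → ∃ λ aτ → let G = sortedFrames nfFrame aτ in σBr π ≐ Frame.orthant G (Frame.full G)
  to π = (R ⟨$⟩ʳ zero , Perm.flip (Perm.remove zero R)) ,
    σBr-sorted π (R ⟨$⟩ʳ zero) (Perm.flip (Perm.remove zero R)) refl (Perm.punchIn-permute R zero)
    where R = Perm.reverse Perm.∘ₚ Perm.flip π

  from : ∀ aτ → ∃ λ π → let G = sortedFrames nfFrame aτ in σBr π ≐ Frame.orthant G (Frame.full G)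
  from (p , τ) = Perm.flip (Perm.reverse Perm.∘ₚ R) ,
    σBr-sorted (Perm.flip (Perm.reverse Perm.∘ₚ R)) p τ (R-reversed zero)
      (λ m → trans (R-reversed (suc m)) (Perm.insert-punchIn zero p (Perm.flip τ) m))
    where
    R = Perm.insert zero p (Perm.flip τ)

    R-reversed : ∀ m → R ⟨$⟩ʳ opposite (opposite m) ≡ R ⟨$⟩ʳ m
    R-reversed m = cong (R ⟨$⟩ʳ_) (Fin.opposite-involutive m)

Br-≈-Bary-NormalFan : ∀ d → Br d ≈Fan Bary (NormalFan (stdSimplex d))
Br-≈-Bary-NormalFan d = framed-≈Fan (Br-framed-sorted d)
  (bary-framed nfFrame (NormalFan (stdSimplex d)) (NormalFan-framed d) nfFrame-compatible zero)

≈Fan-trans : ∀ {d} {S T U : Fan d} → S ≈Fan T → T ≈Fan U → S ≈Fan U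
≈Fan-trans (S⇒T , T⇒S) (T⇒U , U⇒T) = compose S⇒T T⇒U , compose U⇒T T⇒S
  where
  compose : ∀ {S T U : Fan _} → (∀ s → ∃ λ t → cone S s ≐ cone T t) →
            (∀ t → ∃ λ u → cone T t ≐ cone U u) → ∀ s → ∃ λ u → cone S s ≐ cone U u
  compose S⇒T T⇒U s = let (t , S≐T) = S⇒T s ; (u , T≐U) = T⇒U t in u , ≐-trans S≐T T≐U

theorem5p8 : (d : ℕ) →
    (Br² d ≈Fan Bary (Br d)) × (Br² d ≈Fan Bary (Bary (NormalFan (stdSimplex d))))
theorem5p8 d = Br²-≈-Bary-Br d ,
  ≈Fan-trans {S = Br² d} {Bary (Br d)} {Bary (Bary (NormalFan (stdSimplex d)))} (Br²-≈-Bary-Br d)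
    (bary-≈Fan {S = Br d} {Bary (NormalFan (stdSimplex d))} (Br-≈-Bary-NormalFan d))
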